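{- For every integer $n \geq 5$, $rsat(n,C_4) = 3\left\lceil \frac{n-1}{2}\right\rceil$.
   Context: All graphs are finite, simple and undirected. An edge-coloring of a graph $G$ is a function $\mathcal{C}:E(G)\to\mathbb{N}$; a (sub)graph is rainbow if all its edges have distinct colors. Given a graph $F$, an edge-colored graph $G$ is $F$-rainbow free if it contains no rainbow copy of $F$, and it is $F$-rainbow saturated if it is $F$-rainbow free but adding any nonedge of $G$ with any color on it creates a rainbow copy of $F$. The rainbow saturation number $rsat(n,F)$ is the minimum number of edges of a graph $G$ on $n$ vertices for which some edge-coloring makes $G$ $F$-rainbow saturated. $C_r$ denotes the cycle on $r$ vertices. -}

module Defs where

open import Data.Nat using (ℕ; zero; suc; _+_; _≤_; _<ᵇ_)
open import Data.Bool using (Bool; true; false; _∧_; _∨_; if_then_else_)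
open import Data.Fin using (Fin; toℕ; _≟_)
open import Data.List using (List; map; allFin; cartesianProduct)
open import Data.Nat.ListAction using (sum)
open import Data.Product using (Σ; _×_; _,_; ∃-syntax)
open import Relation.Nullary using (¬_; does)
open import Relation.Binary.PropositionalEquality using (_≡_; _≢_)

record Graph (n : ℕ) : Set where
  field
    adj        : Fin n → Fin n → Bool
    adj-sym    : ∀ i j → adj i j ≡ adj j i
    adj-irrefl : ∀ i → adj i i ≡ false
open Graph public

-- An edge-coloring with colors in ℕ, represented as a symmetric function on
-- ordered pairs (only its values on edges matter).
record Coloring {n : ℕ} (G : Graph n) : Set where
  field
    col     : Fin n → Fin n → ℕ
    col-sym : ∀ i j → col i j ≡ col j i
open Coloring public

edgeCount : ∀ {n} → Graph n → ℕ
edgeCount {n} G =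
  sum (map (λ p → f p) (cartesianProduct (allFin n) (allFin n)))
  where
  f : Fin n × Fin n → ℕ
  f (i , j) = if (toℕ i <ᵇ toℕ j) ∧ adj G i j then 1 else 0

RainbowC4 : ∀ {n} → (Fin n → Fin n → Bool) → (Fin n → Fin n → ℕ) → Set
RainbowC4 {n} A c =
  Σ (Fin n) λ a → Σ (Fin n) λ b → Σ (Fin n) λ d → Σ (Fin n) λ e →
    (a ≢ b) × (a ≢ d) × (a ≢ e) × (b ≢ d) × (b ≢ e) × (d ≢ e) ×
    (A a b ≡ true) × (A b d ≡ true) × (A d e ≡ true) × (A e a ≡ true) ×
    (c a b ≢ c b d) × (c a b ≢ c d e) × (c a b ≢ c e a) ×
    (c b d ≢ c d e) × (c b d ≢ c e a) × (c d e ≢ c e a)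

isPair : ∀ {n} → Fin n → Fin n → Fin n → Fin n → Bool
isPair u v x y = (does (x ≟ u) ∧ does (y ≟ v)) ∨ (does (x ≟ v) ∧ does (y ≟ u))

addAdj : ∀ {n} → (Fin n → Fin n → Bool) → Fin n → Fin n → Fin n → Fin n → Bool
addAdj A u v x y = A x y ∨ isPair u v x y

addCol : ∀ {n} → (Fin n → Fin n → ℕ) → Fin n → Fin n → ℕ → Fin n → Fin n → ℕ
addCol c u v k x y = if isPair u v x y then k else c x y

RainbowSaturatedC4 : ∀ {n} (G : Graph n) → Coloring G → Set
RainbowSaturatedC4 {n} G C =
  (¬ RainbowC4 (adj G) (col C)) ×
  (∀ (u v : Fin n) → u ≢ v → adj G u v ≡ false → ∀ (k : ℕ) →
     RainbowC4 (addAdj (adj G) u v) (addCol (col C) u v k))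

RsatC4 : ℕ → ℕ → Set
RsatC4 n m =
  (Σ (Graph n) λ G → Σ (Coloring G) λ C → RainbowSaturatedC4 G C × edgeCount G ≡ m) ×
  (∀ (G : Graph n) (C : Coloring G) → RainbowSaturatedC4 G C → m ≤ edgeCount G)

{-# OPTIONS --safe #-}

-- Lower bound. For a non-edge uv and any colour k, saturation yields a path u x y v
-- none of whose edges has colour k. If every degree is at least 3, count degrees.
-- Otherwise some u has exactly two neighbours w true and w false. Layer the vertices by
-- their distance from {u , w true , w false} and let each edge give charge 2 to its end
-- in the farther layer, or 1 to each end within a layer. Choosing k to block a
-- given edge shows that every other vertex has charge at least 3 (at least 4 when
-- the two neighbours of u are not adjacent), so 2|E| ≥ 3n − 3. When n is even, parity and
-- one more use of blocking colours exclude 2|E| = 3n − 2: there would be a single vertex of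
-- excess charge, and this forces two twins of degree 2 or an unreachable non-edge.
--
-- Upper bound. Take triangles sharing a vertex, one of them enlarged to K₄ when n is
-- even, with pairwise disjoint palettes of three colours; K₄ is coloured properly.

module Submission where

open import Defs
open import Data.Bool using (Bool; true; false; _∧_; _∨_; not; if_then_else_)
open import Data.Bool.Properties using (∧-zeroʳ; ∨-identityʳ; ∨-zeroʳ; ¬-not; T-≡)
open import Data.Empty using (⊥; ⊥-elim)
open import Data.Fin using (Fin; zero; suc; toℕ; _≟_)
open import Data.Fin.Patterns using (0F; 1F; 2F)
open import Data.Fin.Properties using (any?; toℕ-injective; toℕ<n; ¬∀⟶∃¬; injective⇒≤)
open import Data.List using (List; []; _∷_; _++_; map; cartesianProduct; tabulate; length)
open import Data.List.Membership.DecPropositional using (_∈?_)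
open import Data.List.Membership.Propositional using (_∈_; _∉_)
open import Data.List.Membership.Setoid.Properties using (index-injective)
open import Data.List.Properties using (map-++; map-∘; map-cong-local)
open import Data.List.Relation.Unary.All as All using (All; []; _∷_)
open import Data.List.Relation.Unary.AllPairs using ([]; _∷_)
open import Data.List.Relation.Unary.Any using (here; there; index)
open import Data.List.Relation.Unary.Unique.Propositional using (Unique)
open import Data.Nat using (ℕ; zero; suc; _+_; _≤_; _<_; _*_; _∸_; ⌈_/2⌉; z≤n; s≤s; _<ᵇ_; _≡ᵇ_; _⊔_)
import Data.Nat as ℕ
open import Data.Nat.ListAction using () renaming (sum to sumᴸ)
open import Data.Nat.ListAction.Properties using (sum-++)
open import Data.Nat.Properties hiding (_≟_)
open import Data.Product using (Σ; ∃; ∃-syntax; _×_; _,_; proj₁; proj₂)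
open import Data.Sum using (_⊎_; inj₁; inj₂; [_,_]′)
open import Function using (_∘_; id; Equivalence)
open import Relation.Binary.PropositionalEquality
open import Relation.Nullary using (¬_; Dec; yes; no; does; contradiction)
open import Relation.Nullary.Decidable using (dec-true; dec-false)
open import Algebra.Properties.CommutativeMonoid.Sum +-0-commutativeMonoid
  using (sum; sum-cong-≗; ∑-distrib-+; ∑-comm; sum-replicate-zero)
open import Algebra.Properties.CommutativeSemigroup +-commutativeSemigroup using (x∙yz≈y∙xz; xy∙z≈xz∙y)

private variable
  n : ℕ

-- Finite sums and charges

sum-mono : {s t : Fin n → ℕ} → (∀ i → s i ≤ t i) → sum s ≤ sum t
sum-mono {zero}  le = z≤n
sum-mono {suc n} le = +-mono-≤ (le zero) (sum-mono (le ∘ suc))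

sum-const : ∀ n k → sum {n} (λ _ → k) ≡ n * k
sum-const zero    k = refl
sum-const (suc n) k = cong (k +_) (sum-const n k)

erase : Fin n → (Fin n → ℕ) → Fin n → ℕ
erase x t j = if does (j ≟ x) then 0 else t j

erase-≢ : ∀ {x} (t : Fin n → ℕ) {j} → j ≢ x → erase x t j ≡ t j
erase-≢ {x = x} t {j} ne rewrite dec-false (j ≟ x) ne = refl

sum-erase : ∀ x (t : Fin n → ℕ) → sum t ≡ t x + sum (erase x t)
sum-erase zero    t = refl
sum-erase (suc x) t = begin
  t zero + sum (t ∘ suc)                                ≡⟨ cong (t zero +_) (sum-erase x (t ∘ suc)) ⟩
  t zero + (t (suc x) + sum (erase x (t ∘ suc)))        ≡⟨ x∙yz≈y∙xz (t zero) (t (suc x)) _ ⟩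
  t (suc x) + (t zero + sum (erase x (t ∘ suc)))        ∎
  where open ≡-Reasoning

-- Zeroing the weight of the head leaves the other entries untouched, as they differ from it. With
-- the constant weight 1 this is the pigeonhole bound.
sum-unique-≤ : ∀ (t : Fin n → ℕ) {xs} → Unique xs → sumᴸ (map t xs) ≤ sum t
sum-unique-≤ t []                      = z≤n
sum-unique-≤ t {x ∷ xs} (x∉xs ∷ uniq) = begin
  t x + sumᴸ (map t xs)
    ≡⟨ cong (λ ys → t x + sumᴸ ys) (map-cong-local (All.map (λ x≢y → sym (erase-≢ t (x≢y ∘ sym))) x∉xs)) ⟩
  t x + sumᴸ (map (erase x t) xs)  ≤⟨ +-monoʳ-≤ (t x) (sum-unique-≤ (erase x t) uniq) ⟩
  t x + sum (erase x t)            ≡⟨ sum-erase x t ⟨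
  sum t                            ∎
  where open ≤-Reasoning

sum-zero : {t : Fin n → ℕ} → (∀ j → t j ≡ 0) → sum t ≡ 0
sum-zero {n} eq = trans (sum-cong-≗ eq) (sum-replicate-zero n)

sum-pair : ∀ (t : Fin n → ℕ) {x y} → x ≢ y → (∀ j → j ≢ x → j ≢ y → t j ≡ 0) → sum t ≡ t x + t y
sum-pair t {x} {y} x≢y vanish = begin
  sum t                                        ≡⟨ sum-erase x t ⟩
  t x + sum (erase x t)                        ≡⟨ cong (t x +_) (sum-erase y (erase x t)) ⟩
  t x + (erase x t y + sum (erase y (erase x t)))
    ≡⟨ cong₂ (λ a b → t x + (a + b)) (erase-≢ t (x≢y ∘ sym)) (sum-zero rest) ⟩
  t x + (t y + 0)                              ≡⟨ cong (t x +_) (+-identityʳ (t y)) ⟩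
  t x + t y                                    ∎
  where
  open ≡-Reasoning
  rest : ∀ j → erase y (erase x t) j ≡ 0
  rest j with j ≟ y | j ≟ x
  ... | yes _   | _       = refl
  ... | no _    | yes _   = refl
  ... | no j≢y  | no j≢x  = vanish j j≢x j≢y

sum-excess : ∀ c d {f : Fin n → ℕ} → (∀ i → c ≤ f i) → ∀ i → c + d ≤ f i → n * c + d ≤ sum f
sum-excess {suc n} c d {f} le zero le′ = begin
  c + n * c + d            ≡⟨ xy∙z≈xz∙y c (n * c) d ⟩
  c + d + n * c            ≤⟨ +-mono-≤ le′ (≤-trans (≤-reflexive (sym (sum-const n c))) (sum-mono (le ∘ suc))) ⟩
  f zero + sum (f ∘ suc)   ∎
  where open ≤-Reasoning
sum-excess {suc n} c d {f} le (suc i) le′ = begin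
  c + n * c + d            ≡⟨ +-assoc c (n * c) d ⟩
  c + (n * c + d)          ≤⟨ +-mono-≤ (le zero) (sum-excess c d (le ∘ suc) i le′) ⟩
  f zero + sum (f ∘ suc)   ∎
  where open ≤-Reasoning

-- Separates the three ways a lower bound `n * c` can fail to be improved by 2: no excess at all, a
-- single unit of excess, or the improvement itself. Parity will exclude the first and graph
-- structure the second.
excess : ∀ c (f : Fin n → ℕ) → (∀ i → c ≤ f i) →
         (∀ i → f i ≡ c) ⊎ (∃ λ i → f i ≡ suc c × (∀ j → j ≢ i → f j ≡ c)) ⊎ (n * c + 2 ≤ sum f)
excess {zero}  c f le = inj₁ λ ()
excess {suc n} c f le with m≤n⇒m<n∨m≡n (le zero) | excess c (f ∘ suc) (le ∘ suc)
... | inj₂ eq | inj₁ all = inj₁ λ { zero → sym eq ; (suc i) → all i }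
... | inj₂ eq | inj₂ (inj₁ (i , fi , others)) =
  inj₂ (inj₁ (suc i , fi , λ { zero _ → sym eq ; (suc j) ne → others j (ne ∘ cong suc) }))
... | _ | inj₂ (inj₂ big) =
  inj₂ (inj₂ (≤-trans (≤-reflexive (+-assoc c _ 2)) (+-mono-≤ (le zero) big)))
... | inj₁ lt | inj₂ (inj₁ (i , fi , _)) = inj₂ (inj₂ (begin
  c + n * c + 2                ≡⟨ +-assoc c (n * c) 2 ⟩
  c + (n * c + 2)              ≡⟨ cong (c +_) (+-suc (n * c) 1) ⟩
  c + suc (n * c + 1)          ≡⟨ +-suc c (n * c + 1) ⟩
  suc c + (n * c + 1)
    ≤⟨ +-mono-≤ lt (sum-excess c 1 (le ∘ suc) i (≤-reflexive (trans (+-comm c 1) (sym fi)))) ⟩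
  f zero + sum (f ∘ suc)       ∎))
  where open ≤-Reasoning
... | inj₁ lt | inj₁ all with m≤n⇒m<n∨m≡n lt
...   | inj₂ eq = inj₂ (inj₁ (zero , sym eq , λ { zero ne → ⊥-elim (ne refl) ; (suc j) _ → all j }))
...   | inj₁ lt₂ = inj₂ (inj₂ (begin
  c + n * c + 2                        ≡⟨ +-comm (c + n * c) 2 ⟩
  suc (suc c) + n * c
    ≤⟨ +-mono-≤ lt₂ (≤-reflexive (trans (sym (sum-const n c)) (sym (sum-cong-≗ all)))) ⟩
  f zero + sum (f ∘ suc)               ∎))
  where open ≤-Reasoning

indicator : Fin n → ℕ → Fin n → ℕ
indicator x k v = if does (v ≟ x) then k else 0

indicator-≡ : ∀ (x : Fin n) k → indicator x k x ≡ k
indicator-≡ x k rewrite dec-true (x ≟ x) refl = refl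

indicator-≢ : ∀ {x v : Fin n} k → v ≢ x → indicator x k v ≡ 0
indicator-≢ {x = x} {v} k v≢x rewrite dec-false (v ≟ x) v≢x = refl

sum-indicator : ∀ (x : Fin n) k → sum (indicator x k) ≡ k
sum-indicator x k = begin
  sum (indicator x k)                                 ≡⟨ sum-erase x (indicator x k) ⟩
  indicator x k x + sum (erase x (indicator x k))     ≡⟨ cong₂ _+_ (indicator-≡ x k) (sum-zero vanish) ⟩
  k + 0                                               ≡⟨ +-identityʳ k ⟩
  k                                                   ∎
  where
  open ≡-Reasoning
  vanish : ∀ j → erase x (indicator x k) j ≡ 0
  vanish j with j ≟ x
  ... | yes _ = refl
  ... | no _  = refl

-- If every element occurred, the position of its occurrence would inject `Fin n` into the fewer
-- positions of `xs`.
∃-∉ : ∀ (xs : List (Fin n)) → length xs < n → ∃ (_∉ xs)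
∃-∉ {n} xs short = ¬∀⟶∃¬ n (_∈ xs) (λ i → _∈?_ _≟_ i xs)
  λ all → <⇒≱ short (injective⇒≤ {f = λ i → index (all i)} λ {i} {j} → index-injective (setoid _) (all i) (all j))

-- Double counting of edges

sum-tabulate : ∀ {A : Set} (f : A → ℕ) (g : Fin n → A) → sumᴸ (map f (tabulate g)) ≡ sum (f ∘ g)
sum-tabulate {zero}  f g = refl
sum-tabulate {suc n} f g = cong (f (g zero) +_) (sum-tabulate f (g ∘ suc))

sum-product : ∀ {A B : Set} {m} (f : A × B → ℕ) (g : Fin m → A) (h : Fin n → B) →
  sumᴸ (map f (cartesianProduct (tabulate g) (tabulate h))) ≡ sum (λ i → sum (λ j → f (g i , h j)))
sum-product {m = zero}  f g h = refl
sum-product {m = suc m} f g h = begin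
  sumᴸ (map f (row ++ rest))                ≡⟨ cong sumᴸ (map-++ f row rest) ⟩
  sumᴸ (map f row ++ map f rest)            ≡⟨ sum-++ (map f row) (map f rest) ⟩
  sumᴸ (map f row) + sumᴸ (map f rest)
    ≡⟨ cong₂ _+_ (trans (cong sumᴸ (sym (map-∘ (tabulate h)))) (sum-tabulate _ h)) (sum-product f (g ∘ suc) h) ⟩
  _                                         ∎
  where
  open ≡-Reasoning
  row  = map (g zero ,_) (tabulate h)
  rest = cartesianProduct (tabulate (g ∘ suc)) (tabulate h)

pairCount : (Fin n → Fin n → Bool) → ℕ
pairCount A = sum (λ i → sum (λ j → if (toℕ i <ᵇ toℕ j) ∧ A i j then 1 else 0))

edgeCount-pairCount : (G : Graph n) → edgeCount G ≡ pairCount (adj G)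
edgeCount-pairCount {n} G =
  sum-product {n = n} {m = n} (λ (i , j) → if (toℕ i <ᵇ toℕ j) ∧ adj G i j then 1 else 0) id id

-- Discharging: each edge carries the charge 2, shared between its two ends according to ω.
weigh : (G : Graph n) (ω : Fin n → Fin n → ℕ) → Fin n → Fin n → ℕ
weigh G ω i j = if adj G i j then ω i j else 0

charge : (G : Graph n) (ω : Fin n → Fin n → ℕ) → Fin n → ℕ
charge G ω i = sum (weigh G ω i)

weigh-~ : (G : Graph n) (ω : Fin n → Fin n → ℕ) → ∀ {i j} → adj G i j ≡ true → weigh G ω i j ≡ ω i j
weigh-~ G ω i~j rewrite i~j = refl

charge-≥ : (G : Graph n) (ω : Fin n → Fin n → ℕ) → ∀ {i xs} → Unique xs → All (λ j → adj G i j ≡ true) xs →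
           sumᴸ (map (ω i) xs) ≤ charge G ω i
charge-≥ G ω {i} uniq nbrs =
  ≤-trans (≤-reflexive (cong sumᴸ (map-cong-local (All.map (sym ∘ weigh-~ G ω) nbrs))))
          (sum-unique-≤ (weigh G ω i) uniq)

-- An edge with `i < j` contributes `ω i j + ω j i` at the ordered pair `(i , j)`. Transposing the
-- sum of the second shares moves each of them to the row of its own end, so every row collects
-- exactly the charge of its vertex.
double-count : (G : Graph n) (ω : Fin n → Fin n → ℕ) → (∀ i j → ω i j + ω j i ≡ 2) →
               edgeCount G + edgeCount G ≡ sum (charge G ω)
double-count {n} G ω ω-share = begin
  edgeCount G + edgeCount G
    ≡⟨ cong₂ _+_ (edgeCount-pairCount G) (edgeCount-pairCount G) ⟩
  pairCount A + pairCount A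
    ≡⟨ sum₂-distrib-+ (λ i j → χ (i <ᵇᶠ j ∧ A i j)) (λ i j → χ (i <ᵇᶠ j ∧ A i j)) ⟨
  sum₂ (λ i j → χ (i <ᵇᶠ j ∧ A i j) + χ (i <ᵇᶠ j ∧ A i j))
    ≡⟨ sum₂-cong (λ i j → split i j) ⟩
  sum₂ (λ i j → up i j + up′ i j)
    ≡⟨ sum₂-distrib-+ up up′ ⟩
  sum₂ up + sum₂ up′
    ≡⟨ cong (sum₂ up +_) (∑-comm up′) ⟩
  sum₂ up + sum₂ (λ i j → up′ j i)
    ≡⟨ sum₂-distrib-+ up (λ i j → up′ j i) ⟨
  sum₂ (λ i j → up i j + up′ j i)
    ≡⟨ sum₂-cong merge ⟩
  sum₂ (weigh G ω) ∎
  where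
  open ≡-Reasoning
  A = adj G
  χ : Bool → ℕ
  χ b = if b then 1 else 0
  _<ᵇᶠ_ : Fin n → Fin n → Bool
  i <ᵇᶠ j = toℕ i <ᵇ toℕ j
  infix 8 _<ᵇᶠ_
  sum₂ : (Fin n → Fin n → ℕ) → ℕ
  sum₂ f = sum (λ i → sum (f i))
  sum₂-cong : ∀ {f g} → (∀ i j → f i j ≡ g i j) → sum₂ f ≡ sum₂ g
  sum₂-cong eq = sum-cong-≗ (λ i → sum-cong-≗ (eq i))
  sum₂-distrib-+ : ∀ f g → sum₂ (λ i j → f i j + g i j) ≡ sum₂ f + sum₂ g
  sum₂-distrib-+ f g = trans (sum-cong-≗ (λ i → ∑-distrib-+ (f i) (g i))) (∑-distrib-+ (sum ∘ f) (sum ∘ g))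
  up up′ : Fin n → Fin n → ℕ
  up  i j = if i <ᵇᶠ j ∧ A i j then ω i j else 0
  up′ i j = if i <ᵇᶠ j ∧ A i j then ω j i else 0
  split : ∀ i j → χ (i <ᵇᶠ j ∧ A i j) + χ (i <ᵇᶠ j ∧ A i j) ≡ up i j + up′ i j
  split i j with i <ᵇᶠ j ∧ A i j
  ... | true  = sym (ω-share i j)
  ... | false = refl
  compare : ∀ a b → (a ≡ b) ⊎ ((a <ᵇ b) ≡ true × (b <ᵇ a) ≡ false) ⊎ ((a <ᵇ b) ≡ false × (b <ᵇ a) ≡ true)
  compare zero    zero    = inj₁ refl
  compare zero    (suc b) = inj₂ (inj₁ (refl , refl))
  compare (suc a) zero    = inj₂ (inj₂ (refl , refl))
  compare (suc a) (suc b) with compare a b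
  ... | inj₁ eq = inj₁ (cong suc eq)
  ... | inj₂ r  = inj₂ r
  merge : ∀ i j → up i j + up′ j i ≡ weigh G ω i j
  merge i j with compare (toℕ i) (toℕ j)
  -- On the diagonal nothing is counted, because there are no loops.
  ... | inj₁ eq rewrite toℕ-injective eq | adj-irrefl G j | ∧-zeroʳ (j <ᵇᶠ j) = refl
  ... | inj₂ (inj₁ (p , q)) rewrite p | q = +-identityʳ _
  ... | inj₂ (inj₂ (p , q)) rewrite p | q | adj-sym G j i = refl

-- Adding one edge of a given colour

true? : ∀ b → b ≡ true ⊎ b ≡ false
true? true  = inj₁ refl
true? false = inj₂ refl

isPair-true : ∀ (u v x y : Fin n) → isPair u v x y ≡ true → (x ≡ u × y ≡ v) ⊎ (x ≡ v × y ≡ u)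
isPair-true u v x y eq with x ≟ u | y ≟ v | x ≟ v | y ≟ u
... | yes p | yes q | _     | _     = inj₁ (p , q)
... | yes _ | no _  | yes p | yes q = inj₂ (p , q)
... | no _  | _     | yes p | yes q = inj₂ (p , q)

isPair-avoidˡ : ∀ {u v x : Fin n} y → x ≢ u → x ≢ v → isPair u v x y ≡ false
isPair-avoidˡ {u = u} {v} {x} y x≢u x≢v rewrite dec-false (x ≟ u) x≢u | dec-false (x ≟ v) x≢v = refl

isPair-avoidʳ : ∀ {u v y : Fin n} x → y ≢ u → y ≢ v → isPair u v x y ≡ false
isPair-avoidʳ {u = u} {v} {y} x y≢u y≢v
  rewrite dec-false (y ≟ u) y≢u | dec-false (y ≟ v) y≢v | ∧-zeroʳ (does (x ≟ u)) = ∧-zeroʳ (does (x ≟ v))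

addAdj-old : ∀ (A : Fin n → Fin n → Bool) {u v} x y → isPair u v x y ≡ false →
             addAdj A u v x y ≡ A x y
addAdj-old A x y eq rewrite eq = ∨-identityʳ (A x y)

addCol-old : ∀ (c : Fin n → Fin n → ℕ) {u v k} x y → isPair u v x y ≡ false →
             addCol c u v k x y ≡ c x y
addCol-old c x y eq rewrite eq = refl

addCol-new : ∀ (c : Fin n → Fin n → ℕ) {u v k} x y → isPair u v x y ≡ true →
             addCol c u v k x y ≡ k
addCol-new c x y eq rewrite eq = refl

rotate : ∀ {A : Fin n → Fin n → Bool} {c} → RainbowC4 A c → RainbowC4 A c
rotate (a , b , d , e , ab , ad , ae , bd , be , de , Aab , Abd , Ade , Aea , c₁₂ , c₁₃ , c₁₄ , c₂₃ , c₂₄ , c₃₄) =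
  b , d , e , a , bd , be , ≢-sym ab , de , ≢-sym ad , ≢-sym ae ,
  Abd , Ade , Aea , Aab , c₂₃ , c₂₄ , ≢-sym c₁₂ , c₃₄ , ≢-sym c₁₃ , ≢-sym c₁₄

-- This is 1 + sgn(a - b): the end on the higher level takes both units of an edge, and ends on
-- equal levels take one each.
share : ℕ → ℕ → ℕ
share zero    zero    = 1
share zero    (suc _) = 0
share (suc _) zero    = 2
share (suc a) (suc b) = share a b

share-sym : ∀ a b → share a b + share b a ≡ 2
share-sym zero    zero    = refl
share-sym zero    (suc b) = refl
share-sym (suc a) zero    = refl
share-sym (suc a) (suc b) = share-sym a b

share-≤ : ∀ {a b} → b ≤ a → 1 ≤ share a b
share-≤ {zero}  z≤n     = s≤s z≤n
share-≤ {suc a} z≤n     = s≤s z≤n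
share-≤ {suc a} (s≤s p) = share-≤ p

share-< : ∀ {a b} → b < a → 2 ≤ share a b
share-< {suc a} {zero}  _       = s≤s (s≤s z≤n)
share-< {suc a} {suc b} (s≤s p) = share-< p

-- The two neighbours of a vertex of degree 2 will be indexed by `Bool`, so that `not` exchanges
-- them and one argument serves both.
bool-cases : ∀ i j → j ≡ i ⊎ j ≡ not i
bool-cases true  true  = inj₁ refl
bool-cases true  false = inj₂ refl
bool-cases false true  = inj₂ refl
bool-cases false false = inj₁ refl

-- Out of `n * 4`, one copy of `n` pays for the constant `a ≤ n`, while the surplus `b` cancels.
trim : ∀ {n} e t a b → a ≤ n → n * 4 + b ≤ e + e + (t + (a + b)) → n * 3 ≤ e + e + t
trim {n} e t a b a≤n le = +-cancelʳ-≤ (a + b) (n * 3) (e + e + t) (begin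
  n * 3 + (a + b)        ≤⟨ +-monoʳ-≤ (n * 3) (+-monoˡ-≤ b a≤n) ⟩
  n * 3 + (n + b)        ≡⟨ +-assoc (n * 3) n b ⟨
  n * 3 + n + b          ≡⟨ cong (_+ b) (trans (+-comm (n * 3) n) (sym (*-suc n 3))) ⟩
  n * 4 + b              ≤⟨ le ⟩
  e + e + (t + (a + b))  ≡⟨ +-assoc (e + e) t (a + b) ⟨
  e + e + t + (a + b)    ∎)
  where open ≤-Reasoning

-- Lower bound

module Saturated {n : ℕ} (G : Graph n) (C : Coloring G) (saturated : RainbowSaturatedC4 G C) where

  infix 4 _~_ _≁_
  _~_ _≁_ : Fin n → Fin n → Set
  x ~ y = adj G x y ≡ true
  x ≁ y = adj G x y ≡ false

  c = col C

  ~-sym : ∀ {x y} → x ~ y → y ~ x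
  ~-sym {x} {y} = trans (adj-sym G y x)

  ~-irrefl : ∀ {x y} → x ~ y → x ≢ y
  ~-irrefl {x} p refl with () ← trans (sym p) (adj-irrefl G x)

  ≁⇒¬~ : ∀ {x y} → x ≁ y → ¬ (x ~ y)
  ≁⇒¬~ p q with () ← trans (sym p) q

  -- Paths of length three replacing a non-edge

  Detour : Fin n → Fin n → ℕ → Set
  Detour u v k = ∃[ x ] ∃[ y ] u ~ x × x ~ y × y ~ v × c u x ≢ k × c x y ≢ k × c y v ≢ k

  flip-≢ : ∀ {x y k} → c x y ≢ k → c y x ≢ k
  flip-≢ {x} {y} ne = ne ∘ trans (col-sym C x y)

  reverse : ∀ {u v k} → Detour v u k → Detour u v k
  reverse (x , y , p , q , r , vx≢k , xy≢k , yu≢k) =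
    y , x , ~-sym r , ~-sym q , ~-sym p , flip-≢ yu≢k , flip-≢ xy≢k , flip-≢ vx≢k

  module _ {u v : Fin n} {k : ℕ} where
    private
      A⁺ = addAdj (adj G) u v
      c⁺ = addCol c u v k

    old-edge : ∀ x y → isPair u v x y ≡ false → A⁺ x y ≡ true → x ~ y
    old-edge x y old = trans (sym (addAdj-old (adj G) x y old))

    -- If the first edge of the cycle is the new one, then its other two vertices avoid `u` and `v`.
    -- The remaining three edges are therefore old, and rainbowness keeps their colours away from
    -- `k`.
    detour-through : ((a , b , _) : RainbowC4 A⁺ c⁺) → isPair u v a b ≡ true → Detour u v k
    detour-through (a , b , d , e , ab , ad , ae , bd , be , de , _ , Abd , Ade , Aea ,
                    c₁₂ , c₁₃ , c₁₄ , _) new = orient (isPair-true u v a b new)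
      where
      colour : ∀ x y → isPair u v x y ≡ false → c⁺ a b ≢ c⁺ x y → c x y ≢ k
      colour x y old ne eq = ne (trans (addCol-new c a b new) (trans (sym eq) (sym (addCol-old c x y old))))
      path : d ≢ u → d ≢ v → e ≢ u → e ≢ v → Detour b a k
      path d≢u d≢v e≢u e≢v =
        d , e , old-edge b d bd-old Abd , old-edge d e de-old Ade , old-edge e a ea-old Aea ,
        colour b d bd-old c₁₂ , colour d e de-old c₁₃ , colour e a ea-old c₁₄
        where
        bd-old = isPair-avoidʳ b d≢u d≢v
        de-old = isPair-avoidˡ e d≢u d≢v
        ea-old = isPair-avoidˡ a e≢u e≢v
      orient : (a ≡ u × b ≡ v) ⊎ (a ≡ v × b ≡ u) → Detour u v k
      orient (inj₁ (refl , refl)) = reverse (path (≢-sym ad) (≢-sym bd) (≢-sym ae) (≢-sym be))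
      orient (inj₂ (refl , refl)) = path (≢-sym bd) (≢-sym ad) (≢-sym be) (≢-sym ae)

    -- The cycle is rotated until the new edge comes first. If it does not use the new edge, it is
    -- already a rainbow cycle of `G`, which is excluded.
    detour-in : RainbowC4 A⁺ c⁺ → Detour u v k
    detour-in r@(a , b , d , e , ab , ad , ae , bd , be , de , Aab , Abd , Ade , Aea ,
                 c₁₂ , c₁₃ , c₁₄ , c₂₃ , c₂₄ , c₃₄)
      with true? (isPair u v a b) | true? (isPair u v b d) | true? (isPair u v d e) | true? (isPair u v e a)
    ... | inj₁ p₁ | _       | _       | _       = detour-through r p₁
    ... | inj₂ _  | inj₁ p₂ | _       | _       = detour-through (rotate r) p₂
    ... | inj₂ _  | inj₂ _  | inj₁ p₃ | _       = detour-through (rotate (rotate r)) p₃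
    ... | inj₂ _  | inj₂ _  | inj₂ _  | inj₁ p₄ = detour-through (rotate (rotate (rotate r))) p₄
    ... | inj₂ p₁ | inj₂ p₂ | inj₂ p₃ | inj₂ p₄ = contradiction
      (a , b , d , e , ab , ad , ae , bd , be , de ,
       old-edge a b p₁ Aab , old-edge b d p₂ Abd , old-edge d e p₃ Ade , old-edge e a p₄ Aea ,
       colours a b b d p₁ p₂ c₁₂ , colours a b d e p₁ p₃ c₁₃ , colours a b e a p₁ p₄ c₁₄ ,
       colours b d d e p₂ p₃ c₂₃ , colours b d e a p₂ p₄ c₂₄ , colours d e e a p₃ p₄ c₃₄)
      (proj₁ saturated)
      where
      colours : ∀ x y z w → isPair u v x y ≡ false → isPair u v z w ≡ false →
                c⁺ x y ≢ c⁺ z w → c x y ≢ c z w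
      colours x y z w p q = subst₂ _≢_ (addCol-old c x y p) (addCol-old c z w q)

  detour : ∀ {u v} → u ≢ v → u ≁ v → ∀ k → Detour u v k
  detour u≢v u≁v k = detour-in (proj₂ saturated _ _ u≢v u≁v k)

  -- Every path of length 3 between such twins passes through the pair p, q.
  twins : ∀ {a b p q} → a ≢ b → a ≁ b →
          (∀ {x} → a ~ x → x ≡ p ⊎ x ≡ q) → (∀ {x} → b ~ x → x ≡ p ⊎ x ≡ q) → ⊥
  twins {a} {b} {p} {q} a≢b a≁b a-nbrs b-nbrs
    with detour a≢b a≁b (c p q)
  ... | x , y , ax , xy , yb , _ , xy≢pq , _ with a-nbrs ax | b-nbrs (~-sym yb)
  ...   | inj₁ refl | inj₁ refl = ~-irrefl xy refl
  ...   | inj₁ refl | inj₂ refl = xy≢pq refl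
  ...   | inj₂ refl | inj₁ refl = xy≢pq (col-sym C x y)
  ...   | inj₂ refl | inj₂ refl = ~-irrefl xy refl

  _~?_ : ∀ x y → x ~ y ⊎ x ≁ y
  x ~? y = true? (adj G x y)

  -- Kept opaque so that the double sum behind `edgeCount` does not unfold in the arithmetic below.
  abstract
    ∣E∣ : ℕ
    ∣E∣ = edgeCount G

    ∣E∣≡edgeCount : ∣E∣ ≡ edgeCount G
    ∣E∣≡edgeCount = refl

    handshake : (ω : Fin n → Fin n → ℕ) → (∀ i j → ω i j + ω j i ≡ 2) → ∣E∣ + ∣E∣ ≡ sum (charge G ω)
    handshake = double-count G

  -- That is, 2|E| ≥ 3n - 3 always and 2|E| ≥ 3n - 1 for even n, written without subtraction.
  Bounds : Set
  Bounds = (n * 3 ≤ ∣E∣ + ∣E∣ + 3) × (∀ m → n ≡ m + m → n * 3 ≤ ∣E∣ + ∣E∣ + 1)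

  -- Layers and charges around a vertex of degree two

  module DegreeTwo (u : Fin n) (w : Bool → Fin n) (w-distinct : ∀ i → w i ≢ w (not i))
                   (u~w : ∀ i → u ~ w i) (u-nbrs : ∀ {x} → u ~ x → ∃ λ i → x ≡ w i) where

    Outer : Fin n → Set
    Outer v = v ≢ u × (∀ i → v ≢ w i)

    data Position (v : Fin n) : Set where
      root  : v ≡ u → Position v
      gate  : ∀ i → v ≡ w i → Position v
      outer : Outer v → Position v

    position : ∀ v → Position v
    position v with v ≟ u | v ≟ w true | v ≟ w false
    ... | yes p | _     | _     = root p
    ... | no _  | yes p | _     = gate true p
    ... | no _  | no _  | yes p = gate false p
    ... | no p  | no q  | no r  = outer (p , λ { true → q ; false → r })

    abstract
      -- The distance from {u , w true , w false}, truncated at 2.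
      level : Fin n → ℕ
      level v = if does (v ≟ u) ∨ does (v ≟ w true) ∨ does (v ≟ w false) then 0 else
                if adj G (w true) v ∨ adj G (w false) v then 1 else 2

      level-u : level u ≡ 0
      level-u rewrite dec-true (u ≟ u) refl = refl

      level-w : ∀ i → level (w i) ≡ 0
      level-w true  rewrite dec-true (w true ≟ w true) refl | ∨-zeroʳ (does (w true ≟ u)) = refl
      level-w false
        rewrite dec-true (w false ≟ w false) refl | ∨-zeroʳ (does (w false ≟ w true))
              | ∨-zeroʳ (does (w false ≟ u)) = refl

      level-near : ∀ {v} → Outer v → ∀ i → w i ~ v → level v ≡ 1
      level-near {v} (p , q) i wi~v
        rewrite dec-false (v ≟ u) p | dec-false (v ≟ w true) (q true) | dec-false (v ≟ w false) (q false) with i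
      ... | true  rewrite wi~v = refl
      ... | false rewrite wi~v | ∨-zeroʳ (adj G (w true) v) = refl

      level-far : ∀ {v} → Outer v → (∀ i → w i ≁ v) → level v ≡ 2
      level-far {v} (p , q) far
        rewrite dec-false (v ≟ u) p | dec-false (v ≟ w true) (q true) | dec-false (v ≟ w false) (q false)
              | far true | far false = refl

    ω : Fin n → Fin n → ℕ
    ω x y = share (level x) (level y)

    near? : ∀ v → (∃ λ i → w i ~ v) ⊎ (∀ i → w i ≁ v)
    near? v with w true ~? v | w false ~? v
    ... | inj₁ p | _      = inj₁ (true , p)
    ... | inj₂ _ | inj₁ q = inj₁ (false , q)
    ... | inj₂ p | inj₂ q = inj₂ λ { true → p ; false → q }

    level-≤1 : ∀ {x} i → x ≢ u → w i ~ x → level x ≤ 1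
    level-≤1 {x} i x≢u wi~x with position x
    ... | root p      = contradiction p x≢u
    ... | gate j refl = ≤-trans (≤-reflexive (level-w j)) z≤n
    ... | outer o     = ≤-reflexive (level-near o i wi~x)

    outer⇒≁u : ∀ {v} → Outer v → u ≁ v
    outer⇒≁u {v} (_ , v≢w) with u ~? v
    ... | inj₂ u≁v = u≁v
    ... | inj₁ u~v with i , p ← u-nbrs u~v = contradiction p (v≢w i)

    outer-nbr≢u : ∀ {v x} → Outer v → v ~ x → x ≢ u
    outer-nbr≢u o v~x refl = ≁⇒¬~ (outer⇒≁u o) (~-sym v~x)

    -- Blocking the colour of the edge from `u` to `w (not i)` forces the path from `u` to `v` to
    -- start with `w i`; its next vertex is then a common neighbour of `w i` and `v`.
    via : ∀ {v} → Outer v → ∀ i → ∃ λ x → x ≢ u × w i ~ x × v ~ x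
    via o i with detour (≢-sym (proj₁ o)) (outer⇒≁u o) (c u (w (not i)))
    ... | x , y , u~x , x~y , y~v , ux≢k , _ with u-nbrs u~x
    ...   | j , refl with bool-cases i j
    ...     | inj₁ refl = y , outer-nbr≢u o (~-sym y~v) , x~y , ~-sym y~v
    ...     | inj₂ refl = contradiction refl ux≢k

    -- Blocking the colour of the pair `x₀`, `v` prevents the path from entering `v` through `x₀`.
    -- Its last inner vertex is adjacent to a neighbour of `u`, hence has level at most 1.
    another : ∀ {v} → Outer v → ∀ x₀ → ∃ λ x → x ≢ x₀ × x ≢ u × v ~ x × (∃ λ i → w i ~ x)
    another {v} o x₀ with detour (≢-sym (proj₁ o)) (outer⇒≁u o) (c x₀ v)
    ... | x , y , u~x , x~y , y~v , _ , _ , yv≢k with u-nbrs u~x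
    ...   | i , refl = y , (λ { refl → yv≢k refl }) , outer-nbr≢u o (~-sym y~v) , ~-sym y~v , i , x~y

    charge₁ : ∀ {v x a} → v ~ x → a ≤ ω v x → a ≤ charge G ω v
    charge₁ {v} {x} p a≤ =
      ≤-trans a≤ (≤-trans (m≤m+n (ω v x) 0) (charge-≥ G ω ([] ∷ []) (p ∷ [])))

    charge₂ : ∀ {v x y a b} → v ~ x → v ~ y → x ≢ y → a ≤ ω v x → b ≤ ω v y → a + b ≤ charge G ω v
    charge₂ {v} {x} {y} p q x≢y a≤ b≤ =
      ≤-trans (+-mono-≤ a≤ (≤-trans b≤ (m≤m+n (ω v y) 0)))
              (charge-≥ G ω ((x≢y ∷ []) ∷ [] ∷ []) (p ∷ q ∷ []))

    charge₃ : ∀ {v x y z a b d} → v ~ x → v ~ y → v ~ z → x ≢ y → x ≢ z → y ≢ z →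
              a ≤ ω v x → b ≤ ω v y → d ≤ ω v z → a + (b + d) ≤ charge G ω v
    charge₃ {v} {x} {y} {z} p q r x≢y x≢z y≢z a≤ b≤ d≤ =
      ≤-trans (+-mono-≤ a≤ (+-mono-≤ b≤ (≤-trans d≤ (m≤m+n (ω v z) 0))))
              (charge-≥ G ω ((x≢y ∷ x≢z ∷ []) ∷ (y≢z ∷ []) ∷ [] ∷ []) (p ∷ q ∷ r ∷ []))

    ω-gate : ∀ {v} i j → Outer v → w i ~ v → 2 ≤ ω v (w j)
    ω-gate i j o wi~v = share-< (≤-trans (s≤s (≤-reflexive (level-w j))) (≤-reflexive (sym (level-near o i wi~v))))

    ω-near : ∀ {v x} i → Outer v → w i ~ v → level x ≤ 1 → 1 ≤ ω v x
    ω-near i o wi~v x≤1 = share-≤ (≤-trans x≤1 (≤-reflexive (sym (level-near o i wi~v))))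

    ω-far : ∀ {v x} → Outer v → (∀ i → w i ≁ v) → level x ≤ 1 → 2 ≤ ω v x
    ω-far o far x≤1 = share-< (≤-trans (s≤s x≤1) (≤-reflexive (sym (level-far o far))))

    -- Two distinct neighbours of level at most 1 exist by `via` and `another`; from level 2, each
    -- of these edges brings 2.
    charge-far : ∀ {v} → Outer v → (∀ i → w i ≁ v) → 4 ≤ charge G ω v
    charge-far o far with via o true
    ... | x , x≢u , wt~x , v~x with another o x
    ...   | y , y≢x , y≢u , v~y , i , wi~y =
      charge₂ v~x v~y (≢-sym y≢x) (ω-far o far (level-≤1 true x≢u wt~x)) (ω-far o far (level-≤1 i y≢u wi~y))

    -- A vertex on level 1 receives 2 from an adjacent gate `w i`, and at least 1 from the neighbour
    -- that `another` supplies besides this gate.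
    charge-outer : ∀ {v} → Outer v → 3 ≤ charge G ω v
    charge-outer {v} o with near? v
    ... | inj₂ far = ≤-trans (n≤1+n 3) (charge-far o far)
    ... | inj₁ (i , wi~v) with another o (w i)
    ...   | x , x≢wi , x≢u , v~x , j , wj~x =
      charge₂ (~-sym wi~v) v~x (≢-sym x≢wi) (ω-gate i i o wi~v) (ω-near i o wi~v (level-≤1 j x≢u wj~x))

    charge-both : ∀ {v} i → Outer v → w i ~ v → w (not i) ~ v → 4 ≤ charge G ω v
    charge-both i o p q =
      charge₂ (~-sym p) (~-sym q) (w-distinct i) (ω-gate i i o p) (ω-gate i (not i) o p)

    -- Topped up at u and at the w i, where the charge is low, to make the lower bound uniform.
    total : ℕ → ℕ → Fin n → ℕ
    total k l v = charge G ω v + (indicator u k v + (indicator (w true) l v + indicator (w false) l v))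

    sum-total : ∀ k l → sum (total k l) ≡ ∣E∣ + ∣E∣ + (k + (l + l))
    sum-total k l = begin
      sum (total k l)
        ≡⟨ ∑-distrib-+ (charge G ω) _ ⟩
      sum (charge G ω) + sum (λ v → indicator u k v + (indicator (w true) l v + indicator (w false) l v))
        ≡⟨ cong (sum (charge G ω) +_) (∑-distrib-+ (indicator u k) _) ⟩
      sum (charge G ω) + (sum (indicator u k) + sum (λ v → indicator (w true) l v + indicator (w false) l v))
        ≡⟨ cong (λ s → sum (charge G ω) + (sum (indicator u k) + s)) (∑-distrib-+ (indicator (w true) l) _) ⟩
      sum (charge G ω) + (sum (indicator u k) + (sum (indicator (w true) l) + sum (indicator (w false) l)))
        ≡⟨ cong₂ _+_ (sym (handshake ω (λ i j → share-sym (level i) (level j))))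
             (cong₂ _+_ (sum-indicator u k) (cong₂ _+_ (sum-indicator (w true) l) (sum-indicator (w false) l))) ⟩
      ∣E∣ + ∣E∣ + (k + (l + l)) ∎
      where open ≡-Reasoning

    total-outer : ∀ k l {v} → Outer v → total k l v ≡ charge G ω v
    total-outer k l {v} (p , q)
      rewrite indicator-≢ k p | indicator-≢ l (q true) | indicator-≢ l (q false) = +-identityʳ _

    u≢w : ∀ i → u ≢ w i
    u≢w i = ~-irrefl (u~w i)

    total-u : ∀ k l → total k l u ≡ charge G ω u + k
    total-u k l
      rewrite indicator-≡ u k | indicator-≢ l (u≢w true) | indicator-≢ l (u≢w false) =
      cong (charge G ω u +_) (+-identityʳ k)

    total-w : ∀ k l i → total k l (w i) ≡ charge G ω (w i) + l
    total-w k l true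
      rewrite indicator-≡ (w true) l | indicator-≢ k (≢-sym (u≢w true)) | indicator-≢ l (w-distinct true) =
      cong (charge G ω (w true) +_) (+-identityʳ l)
    total-w k l false
      rewrite indicator-≡ (w false) l | indicator-≢ k (≢-sym (u≢w false)) | indicator-≢ l (w-distinct false) = refl

    ω-u : ∀ i → ω u (w i) ≡ 1
    ω-u i rewrite level-u | level-w i = refl

    ω-wu : ∀ i → ω (w i) u ≡ 1
    ω-wu i rewrite level-u | level-w i = refl

    ω-ww : ∀ i j → ω (w i) (w j) ≡ 1
    ω-ww i j rewrite level-w i | level-w j = refl

    weigh-≁ : ∀ {x y} → x ≁ y → weigh G ω x y ≡ 0
    weigh-≁ x≁y rewrite x≁y = refl

    charge-u : charge G ω u ≡ 2
    charge-u = trans (sum-pair (weigh G ω u) (w-distinct true) vanish)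
      (cong₂ _+_ (trans (weigh-~ G ω (u~w true)) (ω-u true)) (trans (weigh-~ G ω (u~w false)) (ω-u false)))
      where
      vanish : ∀ j → j ≢ w true → j ≢ w false → weigh G ω u j ≡ 0
      vanish j p q with u ~? j
      ... | inj₂ u≁j = weigh-≁ u≁j
      ... | inj₁ u~j with u-nbrs u~j
      ...   | true  , r = contradiction r p
      ...   | false , r = contradiction r q

    -- The two neighbours are adjacent

    module Adjacent (w~w : ∀ i → w i ~ w (not i)) where

      -- The edges to `u` and to the other gate stay within level 0 and bring 1 each; an edge to an
      -- outer vertex gives its whole charge to that vertex.
      charge-w : ∀ i → charge G ω (w i) ≡ 2
      charge-w i = trans (sum-pair (weigh G ω (w i)) (u≢w (not i)) vanish)
        (cong₂ _+_ (trans (weigh-~ G ω (~-sym (u~w i))) (ω-wu i)) (trans (weigh-~ G ω (w~w i)) (ω-ww i (not i))))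
        where
        vanish : ∀ j → j ≢ u → j ≢ w (not i) → weigh G ω (w i) j ≡ 0
        vanish j p q with w i ~? j
        ... | inj₂ wi≁j = weigh-≁ wi≁j
        ... | inj₁ wi~j with position j
        ...   | root r = contradiction r p
        ...   | outer o = trans (weigh-~ G ω wi~j) (cong₂ share (level-w i) (level-near o i wi~j))
        ...   | gate k refl with bool-cases i k
        ...     | inj₁ refl = contradiction refl (~-irrefl wi~j)
        ...     | inj₂ refl = contradiction refl q

      total-≥3 : ∀ v → 3 ≤ total 1 1 v
      total-≥3 v with position v
      ... | root refl   = ≤-reflexive (sym (trans (total-u 1 1) (cong (_+ 1) charge-u)))
      ... | gate i refl = ≤-reflexive (sym (trans (total-w 1 1 i) (cong (_+ 1) (charge-w i))))
      ... | outer o     = ≤-trans (charge-outer o) (≤-reflexive (sym (total-outer 1 1 o)))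

      edges-≥ : n * 3 ≤ ∣E∣ + ∣E∣ + 3
      edges-≥ = begin
        n * 3                            ≡⟨ sum-const n 3 ⟨
        sum {n} (λ _ → 3)                ≤⟨ sum-mono total-≥3 ⟩
        sum (total 1 1)                  ≡⟨ sum-total 1 1 ⟩
        ∣E∣ + ∣E∣ + 3                    ∎
        where open ≤-Reasoning

      -- Exactly one vertex has excess, and that excess is 1.
      module Tight (v₀ : Fin n) (o₀ : Outer v₀) (v₀-charge : charge G ω v₀ ≡ 4)
                   (tight : ∀ {v} → Outer v → v ≢ v₀ → charge G ω v ≡ 3) where

        tight-near : ∀ {v} → Outer v → v ≢ v₀ → ∃ λ i → w i ~ v
        tight-near {v} o v≢v₀ with near? v
        ... | inj₁ near = near
        ... | inj₂ far  = contradiction (charge-far o far) (<⇒≱ (≤-reflexive (cong suc (tight o v≢v₀))))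

        tight-single : ∀ {v} i → Outer v → v ≢ v₀ → w i ~ v → ¬ (w (not i) ~ v)
        tight-single i o v≢v₀ p q =
          <⇒≱ (≤-reflexive (cong suc (tight o v≢v₀))) (charge-both i o p q)

        -- A third neighbour of level at most 1 would raise the charge to 2 + 1 + 1. The restriction
        -- on the level of `j` matters: a neighbour on level 2 takes both units of the edge and
        -- leaves no trace in the charge of `v`.
        tight-nbrs : ∀ {v x} i → Outer v → v ≢ v₀ → w i ~ v → v ~ x → x ≢ w i → level x ≤ 1 →
                     ∀ {j} → level j ≤ 1 → v ~ j → j ≡ w i ⊎ j ≡ x
        tight-nbrs {v} {x} i o v≢v₀ wi~v v~x x≢wi x≤1 {j} j≤1 v~j with j ≟ w i | j ≟ x
        ... | yes p | _     = inj₁ p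
        ... | no _  | yes q = inj₂ q
        ... | no p  | no q  = contradiction
          (charge₃ (~-sym wi~v) v~x v~j (≢-sym x≢wi) (≢-sym p) (≢-sym q)
            (ω-gate i i o wi~v) (ω-near i o wi~v x≤1) (ω-near i o wi~v j≤1))
          (<⇒≱ (≤-reflexive (cong suc (tight o v≢v₀))))

        -- The only candidate to exclude is the other gate, and it is not adjacent to `v`.
        private-outer : ∀ {v x} i → v ~ x → x ≢ u → w i ~ x → w (not i) ≁ v → Outer x
        private-outer {v} {x} i v~x x≢u wi~x not≁v with position x
        ... | root p  = contradiction p x≢u
        ... | outer o = o
        ... | gate j refl with bool-cases i j
        ...   | inj₁ refl = contradiction refl (~-irrefl wi~x)
        ...   | inj₂ refl = contradiction (~-sym v~x) (≁⇒¬~ not≁v)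

        partner : ∀ {v} i → Outer v → w (not i) ≁ v → ∃ λ x → Outer x × w i ~ x × v ~ x
        partner i o not≁v with via o i
        ... | x , x≢u , wi~x , v~x = x , private-outer i v~x x≢u wi~x not≁v , wi~x , v~x

        not~⇒≁ : ∀ {x y} → ¬ (x ~ y) → x ≁ y
        not~⇒≁ {x} {y} ne with x ~? y
        ... | inj₁ p = contradiction p ne
        ... | inj₂ q = q

        tight-partner : ∀ {v} i → Outer v → v ≢ v₀ → w i ~ v → ∃ λ x → Outer x × w i ~ x × v ~ x
        tight-partner i o v≢v₀ wi~v = partner i o (not~⇒≁ (tight-single i o v≢v₀ wi~v))

        near-≤1 : ∀ {v} i → Outer v → w i ~ v → level v ≤ 1
        near-≤1 i o p = ≤-reflexive (level-near o i p)

        level-others : ∀ {j} → j ≢ v₀ → level j ≤ 1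
        level-others {j} j≢v₀ with position j
        ... | root refl   = ≤-trans (≤-reflexive level-u) z≤n
        ... | gate i refl = ≤-trans (≤-reflexive (level-w i)) z≤n
        ... | outer o with i , p ← tight-near o j≢v₀ = near-≤1 i o p

        -- The charge 4 of a far `v₀` leaves room for two neighbours only: `x₁` under `w true` and
        -- `x₂` under `w false`. Let `p` be the partner of `x₁` under `w true`. For the non-edge
        -- from `v₀` to `p`, blocking the colour of the edge to `x₁` forces the path through `x₂`.
        -- The next vertex would be `w true` or `x₁`, and tightness forbids `x₂` to be adjacent to
        -- either.
        impossible-far : (∀ i → w i ≁ v₀) → ⊥
        impossible-far far with partner true o₀ (far false) | partner false o₀ (far true)
        ... | x₁ , o₁ , wt~x₁ , y~x₁ | x₂ , o₂ , wf~x₂ , y~x₂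
          with tight-partner true o₁ (≢-sym (~-irrefl y~x₁)) wt~x₁
        ...   | p , oₚ , wt~p , x₁~p = finish (detour y≢p y≁p (c v₀ x₁))
          where
          y≢p : v₀ ≢ p
          y≢p refl = ≁⇒¬~ (far true) wt~p
          x₁≢y = ≢-sym (~-irrefl y~x₁)
          x₂≢y = ≢-sym (~-irrefl y~x₂)
          x₁≢x₂ : x₁ ≢ x₂
          x₁≢x₂ refl = tight-single true o₁ x₁≢y wt~x₁ wf~x₂
          p≢x₂ : p ≢ x₂
          p≢x₂ refl = tight-single true oₚ (≢-sym y≢p) wt~p wf~x₂
          y-nbrs : ∀ {j} → v₀ ~ j → j ≡ x₁ ⊎ j ≡ x₂
          y-nbrs {j} y~j with j ≟ x₁ | j ≟ x₂
          ... | yes q | _     = inj₁ q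
          ... | no _  | yes q = inj₂ q
          ... | no q  | no r  = contradiction
            (charge₃ y~x₁ y~x₂ y~j x₁≢x₂ (≢-sym q) (≢-sym r)
              (ω-far o₀ far (near-≤1 true o₁ wt~x₁)) (ω-far o₀ far (near-≤1 false o₂ wf~x₂))
              (ω-far o₀ far (level-others (≢-sym (~-irrefl y~j)))))
            (<⇒≱ (≤-trans (≤-reflexive (cong suc v₀-charge)) (n≤1+n 5)))
          y≁p : v₀ ≁ p
          y≁p with v₀ ~? p
          ... | inj₂ q = q
          ... | inj₁ q with y-nbrs q
          ...   | inj₁ refl = contradiction refl (~-irrefl x₁~p)
          ...   | inj₂ r    = contradiction r p≢x₂
          finish : ¬ Detour v₀ p (c v₀ x₁)
          finish (a , b , y~a , a~b , b~p , ya≢k , _) with y-nbrs y~a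
          ... | inj₁ refl = ya≢k refl
          ... | inj₂ refl
            -- As `v₀` is not adjacent to `p`, the vertex `b` differs from `v₀` and so has level at
            -- most 1.
            with tight-nbrs true oₚ (≢-sym y≢p) wt~p (~-sym x₁~p) (proj₂ o₁ true) (near-≤1 true o₁ wt~x₁)
                   (level-others (λ { refl → ≁⇒¬~ y≁p b~p })) (~-sym b~p)
          ...   | inj₁ refl = tight-single true o₂ x₂≢y (~-sym a~b) wf~x₂
          ...   | inj₂ refl
            with tight-nbrs true o₁ x₁≢y wt~x₁ x₁~p (proj₂ oₚ true) (near-≤1 true oₚ wt~p)
                   (near-≤1 false o₂ wf~x₂) (~-sym a~b)
          ...     | inj₁ q = proj₂ o₂ true q
          ...     | inj₂ q = p≢x₂ (sym q)

        module Near (i : Bool) (wi~v₀ : w i ~ v₀) where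

          level-all : ∀ j → level j ≤ 1
          level-all j with j ≟ v₀
          ... | yes refl = near-≤1 i o₀ wi~v₀
          ... | no j≢v₀  = level-others j≢v₀

          -- The two gates already use up the charge 4, so `v₀` has no further neighbour and is a
          -- twin of `u`.
          impossible-both : ¬ (w (not i) ~ v₀)
          impossible-both wn~v₀ = twins (≢-sym (proj₁ o₀)) (outer⇒≁u o₀) nbrs-u nbrs-v₀
            where
            nbrs-u : ∀ {x} → u ~ x → x ≡ w i ⊎ x ≡ w (not i)
            nbrs-u u~x with j , refl ← u-nbrs u~x with bool-cases i j
            ... | inj₁ refl = inj₁ refl
            ... | inj₂ refl = inj₂ refl
            nbrs-v₀ : ∀ {x} → v₀ ~ x → x ≡ w i ⊎ x ≡ w (not i)
            nbrs-v₀ {x} v₀~x with x ≟ w i | x ≟ w (not i)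
            ... | yes p | _     = inj₁ p
            ... | no _  | yes q = inj₂ q
            ... | no p  | no q  = contradiction
              (charge₃ (~-sym wi~v₀) (~-sym wn~v₀) v₀~x (w-distinct i) (≢-sym p) (≢-sym q)
                (ω-gate i i o₀ wi~v₀) (ω-gate i (not i) o₀ wi~v₀) (ω-near i o₀ wi~v₀ (level-all x)))
              (<⇒≱ (≤-reflexive (cong suc v₀-charge)))

          nbrs : ∀ {a} → Outer a → w i ~ a → v₀ ~ a → ∀ {x} → a ~ x → x ≡ w i ⊎ x ≡ v₀
          nbrs {a} o wi~a v₀~a {x} a~x =
            tight-nbrs i o (≢-sym (~-irrefl v₀~a)) wi~a (~-sym v₀~a) (proj₂ o₀ i) (level-all v₀) (level-all x) a~x

          -- Besides `w i` and a partner `a`, the charge 4 demands a third neighbour `d` of `v₀`.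
          -- Both `a` and `d` turn out to have no neighbours except `w i` and `v₀`, so they are
          -- twins.
          impossible-single : ¬ (w (not i) ≁ v₀)
          impossible-single wn≁v₀ with partner i o₀ wn≁v₀
          ... | a , oₐ , wi~a , v₀~a with any? candidate?
            where
            Candidate : Fin n → Set
            Candidate j = v₀ ~ j × j ≢ w i × j ≢ a
            candidate? : ∀ j → Dec (Candidate j)
            candidate? j with v₀ ~? j | j ≟ w i | j ≟ a
            ... | inj₂ p | _     | _     = no λ (q , _) → ≁⇒¬~ p q
            ... | inj₁ _ | yes p | _     = no λ (_ , q , _) → q p
            ... | inj₁ _ | no _  | yes p = no λ (_ , _ , q) → q p
            ... | inj₁ p | no q  | no r  = yes (p , q , r)
          -- Without a third neighbour the charge of `v₀` would be 2 + 1.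
          ...   | no none = contradiction
            (trans (sym v₀-charge) (trans (sum-pair (weigh G ω v₀) (≢-sym (proj₂ oₐ i)) vanish)
              (cong₂ _+_ (trans (weigh-~ G ω (~-sym wi~v₀)) (cong₂ share (level-near o₀ i wi~v₀) (level-w i)))
                         (trans (weigh-~ G ω v₀~a) (cong₂ share (level-near o₀ i wi~v₀) (level-near oₐ i wi~a))))))
            λ ()
            where
            vanish : ∀ j → j ≢ w i → j ≢ a → weigh G ω v₀ j ≡ 0
            vanish j p q with v₀ ~? j
            ... | inj₁ r = contradiction (j , r , p , q) none
            ... | inj₂ r = weigh-≁ r
          ...   | yes (d , v₀~d , d≢wi , d≢a) =
            twins (≢-sym d≢a) a≁d (nbrs oₐ wi~a v₀~a) (nbrs o-d wi~d v₀~d)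
            where
            d≢v₀ = ≢-sym (~-irrefl v₀~d)
            o-d : Outer d
            o-d with position d
            ... | outer o   = o
            ... | root refl = contradiction (~-sym v₀~d) (≁⇒¬~ (outer⇒≁u o₀))
            ... | gate j refl with bool-cases i j
            ...   | inj₁ refl = contradiction refl d≢wi
            ...   | inj₂ refl = contradiction (~-sym v₀~d) (≁⇒¬~ wn≁v₀)
            wi~d : w i ~ d
            wi~d with tight-near o-d d≢v₀
            ... | j , wj~d with bool-cases i j
            ...   | inj₁ refl = wj~d
            -- If `d` were under the other gate, its partner there would have to be that gate or
            -- `v₀`; the former is not outer and the latter is not adjacent to that gate.
            ...   | inj₂ refl with tight-partner (not i) o-d d≢v₀ wj~d
            ...     | x , oₓ , wn~x , d~x
              with tight-nbrs (not i) o-d d≢v₀ wj~d (~-sym v₀~d) (proj₂ o₀ (not i)) (level-all v₀) (level-all x) d~x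
            ...       | inj₁ q    = contradiction q (proj₂ oₓ (not i))
            ...       | inj₂ refl = contradiction wn~x (≁⇒¬~ wn≁v₀)
            a≁d : a ≁ d
            a≁d with a ~? d
            ... | inj₂ q = q
            ... | inj₁ q with nbrs oₐ wi~a v₀~a q
            ...   | inj₁ r = contradiction r d≢wi
            ...   | inj₂ r = contradiction r d≢v₀

        impossible : ⊥
        impossible with near? v₀
        ... | inj₂ far = impossible-far far
        ... | inj₁ (i , wi~v₀) with w (not i) ~? v₀
        ...   | inj₁ p = Near.impossible-both i wi~v₀ p
        ...   | inj₂ p = Near.impossible-single i wi~v₀ p

      -- Improving the bound for even order

      module Even (m : ℕ) (n≡m+m : n ≡ m + m) where

        -- If all totals were 3, then 2|E| + 3 would equal the even number 3n. An excess of 2 or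
        -- more is the claim. A lone unit of excess must sit at an outer vertex, since `u` and the
        -- gates have total exactly 3, and `Tight` refutes that.
        edges-≥-even : n * 3 ≤ ∣E∣ + ∣E∣ + 1
        edges-≥-even with excess 3 (total 1 1) total-≥3
        ... | inj₁ all = contradiction odd≡even (odd≢even ∣E∣ (m * 3))
          where
          -- The odd number 2|E| + 3 is put in the form 1 + 2(|E| + 1).
          odd≡even : suc (suc ∣E∣ + suc ∣E∣) ≡ m * 3 + m * 3
          odd≡even = begin
            suc (suc ∣E∣ + suc ∣E∣)        ≡⟨ cong (2 +_) (+-suc ∣E∣ ∣E∣) ⟩
            3 + (∣E∣ + ∣E∣)                ≡⟨ +-comm 3 (∣E∣ + ∣E∣) ⟩
            ∣E∣ + ∣E∣ + 3                  ≡⟨ sum-total 1 1 ⟨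
            sum (total 1 1)                ≡⟨ sum-cong-≗ all ⟩
            sum {n} (λ _ → 3)              ≡⟨ sum-const n 3 ⟩
            n * 3                          ≡⟨ cong (_* 3) n≡m+m ⟩
            (m + m) * 3                    ≡⟨ *-distribʳ-+ 3 m m ⟩
            m * 3 + m * 3                  ∎
            where open ≡-Reasoning
          odd≢even : ∀ a b → suc (suc a + suc a) ≢ b + b
          odd≢even a b eq = even≢odd b (suc a) (begin
            b + (b + 0)                   ≡⟨ cong (b +_) (+-identityʳ b) ⟩
            b + b                         ≡⟨ eq ⟨
            suc (suc a + suc a)           ≡⟨ cong (λ k → suc (suc a + k)) (+-identityʳ (suc a)) ⟨
            suc (suc a + (suc a + 0))     ∎)
            where open ≡-Reasoning
        ... | inj₂ (inj₂ big) = +-cancelʳ-≤ 2 _ _ (begin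
          n * 3 + 2                            ≤⟨ big ⟩
          sum (total 1 1)                      ≡⟨ sum-total 1 1 ⟩
          ∣E∣ + ∣E∣ + 3                        ≡⟨ +-assoc _ 1 2 ⟨
          ∣E∣ + ∣E∣ + 1 + 2                    ∎)
          where open ≤-Reasoning
        ... | inj₂ (inj₁ (v₀ , v₀-total , others)) with position v₀
        ...   | root refl with () ← trans (sym v₀-total) (trans (total-u 1 1) (cong (_+ 1) charge-u))
        ...   | gate i refl with () ← trans (sym v₀-total) (trans (total-w 1 1 i) (cong (_+ 1) (charge-w i)))
        ...   | outer o = ⊥-elim (Tight.impossible v₀ o (trans (sym (total-outer 1 1 o)) v₀-total)
                            λ {v} oᵥ v≢v₀ → trans (sym (total-outer 1 1 oᵥ)) (others v v≢v₀))

    -- The two neighbours are not adjacent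

    module NonAdjacent (w≁w : ∀ i → w i ≁ w (not i)) where

      nbr-outer : ∀ {x} i → x ≢ u → w i ~ x → Outer x
      nbr-outer {x} i x≢u wi~x with position x
      ... | root p  = contradiction p x≢u
      ... | outer o = o
      ... | gate j refl with bool-cases i j
      ...   | inj₁ refl = contradiction refl (~-irrefl wi~x)
      ...   | inj₂ refl = contradiction wi~x (≁⇒¬~ (w≁w i))

      via-outer : ∀ {v} → Outer v → ∀ i → ∃ λ x → Outer x × w i ~ x × v ~ x
      via-outer o i with via o i
      ... | x , x≢u , wi~x , v~x = x , nbr-outer i x≢u wi~x , wi~x , v~x

      -- Now every neighbour of a gate other than `u` is outer, so the neighbours given by `via` and
      -- `another` are both different from the gate: 2 + 1 + 1.
      charge-≥4 : ∀ {v} → Outer v → 4 ≤ charge G ω v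
      charge-≥4 {v} o with near? v
      ... | inj₂ far = charge-far o far
      ... | inj₁ (i , wi~v) with via-outer o i
      ...   | x , oₓ , wi~x , v~x with another o x
      ...     | y , y≢x , y≢u , v~y , j , wj~y =
        charge₃ (~-sym wi~v) v~x v~y (≢-sym (proj₂ oₓ i)) (≢-sym (proj₂ oᵧ i)) (≢-sym y≢x)
          (ω-gate i i o wi~v) (ω-near i o wi~v (level-≤1 i (proj₁ oₓ) wi~x)) (ω-near i o wi~v (level-≤1 j y≢u wj~y))
        where oᵧ = nbr-outer j y≢u wj~y

      charge-both-≥6 : ∀ {v} → Outer v → (∀ i → w i ~ v) → 6 ≤ charge G ω v
      charge-both-≥6 {v} o w~v with via-outer o true
      ... | x , oₓ , wt~x , v~x with another o x
      ...   | y , y≢x , y≢u , v~y , j , wj~y = begin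
        2 + (2 + (1 + (1 + 0)))
          ≤⟨ +-mono-≤ (ω-gate true true o (w~v true)) (+-mono-≤ (ω-gate true false o (w~v true))
             (+-mono-≤ (ω-near true o (w~v true) (level-≤1 true (proj₁ oₓ) wt~x))
             (+-monoˡ-≤ 0 (ω-near true o (w~v true) (level-≤1 j y≢u wj~y))))) ⟩
        ω v (w true) + (ω v (w false) + (ω v x + (ω v y + 0)))
          ≤⟨ charge-≥ G ω {xs = w true ∷ w false ∷ x ∷ y ∷ []}
               ((w-distinct true ∷ ≢-sym (proj₂ oₓ true) ∷ ≢-sym (proj₂ oᵧ true) ∷ []) ∷
                (≢-sym (proj₂ oₓ false) ∷ ≢-sym (proj₂ oᵧ false) ∷ []) ∷ (≢-sym y≢x ∷ []) ∷ [] ∷ [])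
               (~-sym (w~v true) ∷ ~-sym (w~v false) ∷ v~x ∷ v~y ∷ []) ⟩
        charge G ω v ∎
        where
        open ≤-Reasoning
        oᵧ = nbr-outer j y≢u wj~y

      -- A gate keeps only the unit from its edge to `u`, hence the top-up 3 there and 2 at `u`;
      -- together they cost 2 + 3 + 3 = 8.
      total-≥4 : ∀ v → 4 ≤ total 2 3 v
      total-≥4 v with position v
      ... | root refl   = ≤-reflexive (sym (trans (total-u 2 3) (cong (_+ 2) charge-u)))
      ... | gate i refl = ≤-trans (+-monoˡ-≤ 3 (charge₁ (~-sym (u~w i)) (≤-reflexive (sym (ω-wu i)))))
                            (≤-reflexive (sym (total-w 2 3 i)))
      ... | outer o     = ≤-trans (charge-≥4 o) (≤-reflexive (sym (total-outer 2 3 o)))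

      edges-≥ : n * 4 ≤ ∣E∣ + ∣E∣ + 8
      edges-≥ = begin
        n * 4                            ≡⟨ sum-const n 4 ⟨
        sum {n} (λ _ → 4)                ≤⟨ sum-mono total-≥4 ⟩
        sum (total 2 3)                  ≡⟨ sum-total 2 3 ⟩
        ∣E∣ + ∣E∣ + 8                    ∎
        where open ≤-Reasoning

      edges-≥-both : ∀ {v} → Outer v → (∀ i → w i ~ v) → n * 4 + 2 ≤ ∣E∣ + ∣E∣ + 8
      edges-≥-both {v} o w~v = begin
        n * 4 + 2
          ≤⟨ sum-excess 4 2 {total 2 3} total-≥4 v (subst (6 ≤_) (sym (total-outer 2 3 o)) (charge-both-≥6 o w~v)) ⟩
        sum (total 2 3)                  ≡⟨ sum-total 2 3 ⟩
        ∣E∣ + ∣E∣ + 8                    ∎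
        where open ≤-Reasoning

      four-outer : ∀ {a b d e} → Outer a → Outer b → Outer d → Outer e →
                   a ≢ b → a ≢ d → a ≢ e → b ≢ d → b ≢ e → d ≢ e → 7 ≤ n
      four-outer oa ob od oe ab ad ae bd be de = begin
        7                    ≤⟨ sum-unique-≤ (λ _ → 1) {_ ∷ _ ∷ _ ∷ _ ∷ _ ∷ _ ∷ _ ∷ []}
                                  ((u≢w true ∷ u≢w false ∷ out₀ oa ∷ out₀ ob ∷ out₀ od ∷ out₀ oe ∷ []) ∷
                                   (w-distinct true ∷ out true oa ∷ out true ob ∷ out true od ∷ out true oe ∷ []) ∷
                                   (out false oa ∷ out false ob ∷ out false od ∷ out false oe ∷ []) ∷
                                   (ab ∷ ad ∷ ae ∷ []) ∷ (bd ∷ be ∷ []) ∷ (de ∷ []) ∷ [] ∷ []) ⟩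
        sum {n} (λ _ → 1)    ≡⟨ sum-const n 1 ⟩
        n * 1                ≡⟨ *-identityʳ n ⟩
        n                    ∎
        where
        open ≤-Reasoning
        out₀ : ∀ {x} → Outer x → u ≢ x
        out₀ = ≢-sym ∘ proj₁
        out : ∀ i {x} → Outer x → w i ≢ x
        out i o = ≢-sym (proj₂ o i)

      Common : Set
      Common = ∃ λ v → Outer v × (∀ i → w i ~ v)

      common : ∀ {v} i → Outer v → w i ~ v → w (not i) ~ v → Common
      common true  o p q = _ , o , λ { true → p ; false → q }
      common false o p q = _ , o , λ { true → q ; false → p }

      -- The bound with loss 8 is too weak for n = 6, so it has to be sharpened there. An outer `v`
      -- has common neighbours `x` with `w true` and `x′` with `w false`. If they coincide, a common
      -- neighbour of the gates is found. Otherwise a common neighbour `y` of `x` and its gate is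
      -- examined, and likewise for `x′`.
      common-or-large : 4 ≤ n → Common ⊎ 7 ≤ n
      common-or-large 4≤n with ∃-∉ (u ∷ w true ∷ w false ∷ []) 4≤n
      ... | v , v∉ = split (via-outer oᵥ true) (via-outer oᵥ false)
        where
        oᵥ : Outer v
        oᵥ = (λ { refl → v∉ (here refl) }) ,
             λ { true refl → v∉ (there (here refl)) ; false refl → v∉ (there (there (here refl))) }
        Via : Bool → Fin n → Set
        Via i v = ∃ λ x → Outer x × w i ~ x × v ~ x
        -- Either `y` is `v`, or it is `x′` and thus adjacent to both gates, or `v`, `x`, `x′`, `y`
        -- are four outer vertices, which with `u` and the gates make seven.
        close : ∀ i {x x′} → Outer x → w i ~ x → v ~ x → Outer x′ → w (not i) ~ x′ → v ~ x′ → x ≢ x′ →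
                Via i x → (Common ⊎ 7 ≤ n) ⊎ w i ~ v
        close i {x} {x′} o p v~x o′ p′ v~x′ x≢x′ (y , oᵧ , wi~y , x~y) with y ≟ v | y ≟ x′
        ... | yes refl | _        = inj₂ wi~y
        ... | no _     | yes refl = inj₁ (inj₁ (common i o′ wi~y p′))
        ... | no y≢v   | no y≢x′  = inj₁ (inj₂ (four-outer oᵥ o o′ oᵧ (~-irrefl v~x) (~-irrefl v~x′) (≢-sym y≢v)
                                      x≢x′ (~-irrefl x~y) (≢-sym y≢x′)))
        split : Via true v → Via false v → Common ⊎ 7 ≤ n
        split (x , o , p , v~x) (x′ , o′ , p′ , v~x′) with x ≟ x′
        ... | yes refl = inj₁ (common true o p p′)
        ... | no x≢x′ with close true o p v~x o′ p′ v~x′ x≢x′ (via-outer o true)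
                         | close false o′ p′ v~x′ o p v~x (≢-sym x≢x′) (via-outer o′ false)
        ...   | inj₁ r | _      = r
        ...   | inj₂ _ | inj₁ r = r
        ...   | inj₂ q | inj₂ r = inj₁ (common true oᵥ q r)

    bounds : 5 ≤ n → Bounds
    bounds 5≤n with w true ~? w false
    ... | inj₁ wt~wf = Adjacent.edges-≥ w~w , Adjacent.Even.edges-≥-even w~w
      where
      w~w : ∀ i → w i ~ w (not i)
      w~w true  = wt~wf
      w~w false = ~-sym wt~wf
    -- The loss 8 is split as 3 + 5 here, and for even order as 1 + 5 + 2 with the surplus 2 of a
    -- common neighbour, or as 1 + 7 when n ≥ 7.
    ... | inj₂ wt≁wf = trim ∣E∣ 3 5 0 5≤n edges-≥-+0 , λ _ _ → even
      where
      w≁w : ∀ i → w i ≁ w (not i)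
      w≁w true  = wt≁wf
      w≁w false = trans (adj-sym G _ _) wt≁wf
      open NonAdjacent w≁w
      edges-≥-+0 : n * 4 + 0 ≤ ∣E∣ + ∣E∣ + 8
      edges-≥-+0 = ≤-trans (≤-reflexive (+-identityʳ (n * 4))) edges-≥
      even : n * 3 ≤ ∣E∣ + ∣E∣ + 1
      even = [ (λ (v , o , w~v) → trim ∣E∣ 1 5 2 5≤n (edges-≥-both o w~v))
             , (λ 7≤n → trim ∣E∣ 1 7 0 7≤n edges-≥-+0) ]′ (common-or-large (≤-trans (n≤1+n 4) 5≤n))

  -- Reduction to a vertex of degree two

  degree : Fin n → ℕ
  degree = charge G (λ _ _ → 1)

  edges-by-degree : (∀ v → 3 ≤ degree v) → n * 3 ≤ ∣E∣ + ∣E∣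
  edges-by-degree deg≥3 = begin
    n * 3                        ≡⟨ sum-const n 3 ⟨
    sum {n} (λ _ → 3)            ≤⟨ sum-mono deg≥3 ⟩
    sum degree                   ≡⟨ handshake (λ _ _ → 1) (λ _ _ → refl) ⟨
    ∣E∣ + ∣E∣                    ∎
    where open ≤-Reasoning

  three-nbrs : ∀ {u x y z} → u ~ x → u ~ y → u ~ z → x ≢ y → x ≢ z → y ≢ z → 3 ≤ degree u
  three-nbrs p q r x≢y x≢z y≢z =
    charge-≥ G (λ _ _ → 1) ((x≢y ∷ x≢z ∷ []) ∷ (y≢z ∷ []) ∷ [] ∷ []) (p ∷ q ∷ r ∷ [])

  non-nbr : 4 ≤ n → ∀ {u} → degree u < 3 → ∃ λ v → u ≢ v × u ≁ v
  non-nbr 4≤n {u} deg<3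
    with x , x∉ ← ∃-∉ (u ∷ []) (≤-trans (s≤s (s≤s z≤n)) 4≤n)
    with y , y∉ ← ∃-∉ (u ∷ x ∷ []) (≤-trans (s≤s (s≤s (s≤s z≤n))) 4≤n)
    with z , z∉ ← ∃-∉ (u ∷ x ∷ y ∷ []) 4≤n
    with u ~? x | u ~? y | u ~? z
  ... | inj₂ u≁x | _        | _        = x , (λ { refl → x∉ (here refl) }) , u≁x
  ... | inj₁ _   | inj₂ u≁y | _        = y , (λ { refl → y∉ (here refl) }) , u≁y
  ... | inj₁ _   | inj₁ _   | inj₂ u≁z = z , (λ { refl → z∉ (here refl) }) , u≁z
  ... | inj₁ u~x | inj₁ u~y | inj₁ u~z = contradiction
    (three-nbrs u~x u~y u~z (λ { refl → y∉ (there (here refl)) }) (λ { refl → z∉ (there (here refl)) })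
      (λ { refl → z∉ (there (there (here refl))) }))
    (<⇒≱ deg<3)

  -- A vertex of degree below 3 has a non-neighbour `v`. A first path to `v` gives a neighbour `x`,
  -- and blocking the colour of the edge to `x` gives a second one, so the degree is exactly 2.
  low-degree-bounds : 5 ≤ n → ∀ {u} → degree u < 3 → Bounds
  low-degree-bounds 5≤n {u} deg<3
    with v , u≢v , u≁v ← non-nbr (≤-trans (n≤1+n 4) 5≤n) deg<3
    -- Any colour would serve in place of 0.
    with x , _ , u~x , _ ← detour u≢v u≁v 0
    with y , _ , u~y , _ , _ , uy≢ux , _ ← detour u≢v u≁v (c u x) =
    DegreeTwo.bounds u w w-distinct u~w u-nbrs 5≤n
    where
    x≢y : x ≢ y
    x≢y refl = uy≢ux refl
    w : Bool → Fin n
    w b = if b then x else y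
    w-distinct : ∀ i → w i ≢ w (not i)
    w-distinct true  = x≢y
    w-distinct false = ≢-sym x≢y
    u~w : ∀ i → u ~ w i
    u~w true  = u~x
    u~w false = u~y
    u-nbrs : ∀ {z} → u ~ z → ∃ λ i → z ≡ w i
    u-nbrs {z} u~z with z ≟ x | z ≟ y
    ... | yes p | _     = true , p
    ... | no _  | yes p = false , p
    ... | no p  | no q  = contradiction (three-nbrs u~x u~y u~z x≢y (≢-sym p) (≢-sym q)) (<⇒≱ deg<3)

  bounds : 5 ≤ n → Bounds
  bounds 5≤n = [ (λ (u , deg<3) → low-degree-bounds 5≤n deg<3) , dense ]′ low-degree?
    where
    low-degree? : (∃ λ u → degree u < 3) ⊎ (∀ u → 3 ≤ degree u)
    low-degree? with any? (λ u → degree u ℕ.<? 3)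
    ... | yes p = inj₁ p
    ... | no p  = inj₂ λ u → ≮⇒≥ (λ q → p (u , q))
    dense : (∀ u → 3 ≤ degree u) → Bounds
    dense deg≥3 = ≤-trans (edges-by-degree deg≥3) (m≤m+n _ 3) , λ _ _ → ≤-trans (edges-by-degree deg≥3) (m≤m+n _ 1)

-- From the doubled bounds to the ceiling

even-or-odd : ∀ n → ∃ λ m → n ≡ m + m ⊎ n ≡ suc (m + m)
even-or-odd zero = 0 , inj₁ refl
even-or-odd (suc n) with even-or-odd n
... | m , inj₁ refl = m , inj₂ refl
... | m , inj₂ refl = suc m , inj₁ (cong suc (sym (+-suc m m)))

halve : ∀ a b → a + a ≤ b + b + 1 → a ≤ b
halve a b le = ≮⇒≥ λ b<a → <⇒≱ (begin
  suc (b + b + 1)    ≡⟨ cong suc (+-comm (b + b) 1) ⟩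
  2 + (b + b)        ≡⟨ cong suc (+-suc b b) ⟨
  suc b + suc b      ≤⟨ +-mono-≤ b<a b<a ⟩
  a + a              ∎) le
  where open ≤-Reasoning

⌈m+m∸1/2⌉≡m : ∀ m → ⌈ m + m ∸ 1 /2⌉ ≡ m
⌈m+m∸1/2⌉≡m zero    = refl
⌈m+m∸1/2⌉≡m (suc m) = trans (cong ⌈_/2⌉ (+-suc m m)) (cong suc (sym (n≡⌊n+n/2⌋ m)))

-- For n = 2m the even bound reads 6m ≤ 2e + 1, and for n = 2m + 1 the loose one reads 6m ≤ 2e;
-- either way 3m ≤ e.
halve-bounds : ∀ n e → n * 3 ≤ e + e + 3 → (∀ m → n ≡ m + m → n * 3 ≤ e + e + 1) →
               3 * ⌈ n ∸ 1 /2⌉ ≤ e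
halve-bounds n e loose even with even-or-odd n
... | m , inj₁ refl = halve (3 * ⌈ m + m ∸ 1 /2⌉) e (begin
  3 * ⌈ m + m ∸ 1 /2⌉ + 3 * ⌈ m + m ∸ 1 /2⌉  ≡⟨ cong (λ k → 3 * k + 3 * k) (⌈m+m∸1/2⌉≡m m) ⟩
  3 * m + 3 * m                              ≡⟨ *-distribˡ-+ 3 m m ⟨
  3 * (m + m)                                ≡⟨ *-comm 3 (m + m) ⟩
  (m + m) * 3                                ≤⟨ even m refl ⟩
  e + e + 1                                  ∎)
  where open ≤-Reasoning
... | m , inj₂ refl = halve (3 * ⌈ m + m /2⌉) e (begin
  3 * ⌈ m + m /2⌉ + 3 * ⌈ m + m /2⌉  ≡⟨ cong (λ k → 3 * k + 3 * k) (n≡⌈n+n/2⌉ m) ⟨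
  3 * m + 3 * m                      ≡⟨ *-distribˡ-+ 3 m m ⟨
  3 * (m + m)                        ≡⟨ *-comm 3 (m + m) ⟩
  (m + m) * 3                        ≤⟨ +-cancelʳ-≤ 3 _ _ (≤-trans (≤-reflexive (+-comm _ 3)) loose) ⟩
  e + e                              ≤⟨ m≤m+n (e + e) 1 ⟩
  e + e + 1                          ∎)
  where open ≤-Reasoning

lower-bound : 5 ≤ n → (G : Graph n) (C : Coloring G) → RainbowSaturatedC4 G C →
              3 * ⌈ n ∸ 1 /2⌉ ≤ edgeCount G
lower-bound {n} 5≤n G C sat =
  subst (3 * ⌈ n ∸ 1 /2⌉ ≤_) ∣E∣≡edgeCount (halve-bounds n ∣E∣ (proj₁ (bounds 5≤n)) (proj₂ (bounds 5≤n)))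
  where open Saturated G C sat

-- Upper bound

addAdj-new : ∀ (A : Fin n → Fin n → Bool) {u v} x y → isPair u v x y ≡ true → addAdj A u v x y ≡ true
addAdj-new A x y eq rewrite eq = ∨-zeroʳ (A x y)

-- member b l is the vertex of block b with label l; adding the centre to a block makes it a clique.
data Code : Set where
  centre : Code
  member : ℕ → Fin 3 → Code

member-injectiveʳ : ∀ {b b′ l l′} → member b l ≡ member b′ l′ → l ≡ l′
member-injectiveʳ refl = refl

member-injectiveˡ : ∀ {b b′ l l′} → member b l ≡ member b′ l′ → b ≡ b′
member-injectiveˡ refl = refl

joined : Code → Code → Bool
joined centre       centre         = false
joined centre       (member _ _)   = true
joined (member _ _) centre         = true
joined (member b l) (member b′ l′) = (b ≡ᵇ b′) ∧ not (does (l ≟ l′))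

-- The label missing from a pair; the values on the diagonal play no role.
third : Fin 3 → Fin 3 → Fin 3
third 0F 0F = 0F
third 0F 1F = 2F
third 0F 2F = 1F
third 1F 0F = 2F
third 1F 1F = 1F
third 1F 2F = 0F
third 2F 0F = 1F
third 2F 1F = 0F
third 2F 2F = 2F

third-comm : ∀ l m → third l m ≡ third m l
third-comm 0F 0F = refl
third-comm 0F 1F = refl
third-comm 0F 2F = refl
third-comm 1F 0F = refl
third-comm 1F 1F = refl
third-comm 1F 2F = refl
third-comm 2F 0F = refl
third-comm 2F 1F = refl
third-comm 2F 2F = refl

third-≢ˡ : ∀ {l m} → l ≢ m → third l m ≢ l
third-≢ˡ {0F} {0F} l≢m _ = l≢m refl
third-≢ˡ {1F} {1F} l≢m _ = l≢m refl
third-≢ˡ {2F} {2F} l≢m _ = l≢m refl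
third-≢ˡ {0F} {1F} _ ()
third-≢ˡ {0F} {2F} _ ()
third-≢ˡ {1F} {0F} _ ()
third-≢ˡ {1F} {2F} _ ()
third-≢ˡ {2F} {0F} _ ()
third-≢ˡ {2F} {1F} _ ()

third-≢ʳ : ∀ {l m} → l ≢ m → third l m ≢ m
third-≢ʳ {l} {m} l≢m eq = third-≢ˡ (≢-sym l≢m) (trans (third-comm m l) eq)

-- This is 3b + l: block `b` owns the palette 3b, 3b + 1, 3b + 2.
paint : Fin 3 → ℕ → ℕ
paint l zero    = toℕ l
paint l (suc b) = 3 + paint l b

paint-injective : ∀ {l l′} b b′ → paint l b ≡ paint l′ b′ → l ≡ l′ × b ≡ b′
paint-injective zero zero eq = toℕ-injective eq , refl
paint-injective {l} {l′} zero (suc b′) eq =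
  contradiction (toℕ<n l) (≤⇒≯ (≤-trans (m≤m+n 3 (paint l′ b′)) (≤-reflexive (sym eq))))
paint-injective {l} {l′} (suc b) zero eq =
  contradiction (toℕ<n l′) (≤⇒≯ (≤-trans (m≤m+n 3 (paint l b)) (≤-reflexive eq)))
paint-injective (suc b) (suc b′) eq with refl , refl ← paint-injective b b′ (+-cancelˡ-≡ 3 _ _ eq) = refl , refl

paint-≢-label : ∀ {l l′} b b′ → l ≢ l′ → paint l b ≢ paint l′ b′
paint-≢-label b b′ ne = ne ∘ proj₁ ∘ paint-injective b b′

paint-≢-block : ∀ {l l′ b b′} → b ≢ b′ → paint l b ≢ paint l′ b′
paint-≢-block {b = b} {b′} ne = ne ∘ proj₂ ∘ paint-injective b b′

-- On the centre and one block this is a proper 3-edge-colouring of (a subgraph of) K₄.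
colour : Code → Code → ℕ
colour centre       centre         = 0
colour centre       (member b l)   = paint l b
colour (member b l) centre         = paint l b
colour (member b l) (member b′ l′) = paint (third l l′) (b ⊔ b′)

≡ᵇ-refl : ∀ b → (b ≡ᵇ b) ≡ true
≡ᵇ-refl b = Equivalence.to T-≡ (≡⇒≡ᵇ b b refl)

≡ᵇ-≢ : ∀ {b b′} → b ≢ b′ → (b ≡ᵇ b′) ≡ false
≡ᵇ-≢ {b} {b′} ne = ¬-not (ne ∘ ≡ᵇ⇒≡ b b′ ∘ Equivalence.from T-≡)

joined-mates : ∀ {b l l′} → l ≢ l′ → joined (member b l) (member b l′) ≡ true
joined-mates {b} {l} {l′} ne rewrite ≡ᵇ-refl b | dec-false (l ≟ l′) ne = refl

joined-blocks : ∀ {b b′ l l′} → joined (member b l) (member b′ l′) ≡ true → b ≡ b′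
joined-blocks {b} {b′} eq with b ℕ.≟ b′
... | yes p = p
... | no p rewrite ≡ᵇ-≢ p with () ← eq

joined-sym : ∀ x y → joined x y ≡ joined y x
joined-sym centre       centre       = refl
joined-sym centre       (member _ _) = refl
joined-sym (member _ _) centre       = refl
joined-sym (member b l) (member b′ l′) with b ℕ.≟ b′ | l ≟ l′
... | no p     | _        rewrite ≡ᵇ-≢ p | ≡ᵇ-≢ (≢-sym p) = refl
... | yes refl | yes refl rewrite dec-true (l ≟ l) refl = refl
... | yes refl | no q     rewrite dec-false (l′ ≟ l) (≢-sym q) = refl

joined-irrefl : ∀ x → joined x x ≡ false
joined-irrefl centre       = refl
joined-irrefl (member b l) rewrite dec-true (l ≟ l) refl = ∧-zeroʳ (b ≡ᵇ b)

-- The maximum of the two block numbers is chosen for this symmetry; on an edge between members both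
-- numbers agree and it is their common value.
colour-sym : ∀ x y → colour x y ≡ colour y x
colour-sym centre       centre         = refl
colour-sym centre       (member _ _)   = refl
colour-sym (member _ _) centre         = refl
colour-sym (member b l) (member b′ l′) = cong₂ paint (third-comm l l′) (⊔-comm b b′)

InBlock : ℕ → Code → Set
InBlock b x = x ≡ centre ⊎ ∃ λ l → x ≡ member b l

block-step : ∀ b l x → joined (member b l) x ≡ true → InBlock b x
block-step b l centre         _ = inj₁ refl
block-step b l (member b′ l′) p with refl ← joined-blocks {b} {b′} {l} {l′} p = inj₂ (l′ , refl)

block-colour : ∀ {b x y} → InBlock b x → InBlock b y → joined x y ≡ true → ∃ λ l → colour x y ≡ paint l b
block-colour (inj₂ (l , refl)) (inj₁ refl)        _ = l , refl
block-colour (inj₁ refl)       (inj₂ (l , refl))  _ = l , refl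
block-colour (inj₁ refl)       (inj₁ refl)        ()
block-colour {b} (inj₂ (l , refl)) (inj₂ (l′ , refl)) _ = third l l′ , cong (paint (third l l′)) (⊔-idem b)

-- Neither adjacent nor opposite vertices are both the centre, so the centre occurs at most once.
-- The other vertices form a path avoiding it, along which the block number is constant.
block-of-cycle : ∀ x y z w → joined x y ≡ true → joined y z ≡ true → joined z w ≡ true → joined w x ≡ true →
                 ¬ (x ≡ centre × z ≡ centre) → ¬ (y ≡ centre × w ≡ centre) →
                 ∃ λ b → InBlock b x × InBlock b y × InBlock b z × InBlock b w
block-of-cycle centre (member b l) z w _ yz zw _ xz _ with block-step b l z yz
... | inj₁ refl       = contradiction (refl , refl) xz
... | inj₂ (m , refl) = b , inj₁ refl , inj₂ (l , refl) , inj₂ (m , refl) , block-step b m w zw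
block-of-cycle (member b l) y z w xy yz zw wx _ yw
  with block-step b l y xy | block-step b l w (trans (joined-sym (member b l) w) wx)
... | inj₁ refl       | inj₁ refl       = contradiction (refl , refl) yw
... | inj₂ (m , refl) | w∈              = b , inj₂ (l , refl) , inj₂ (m , refl) , block-step b m z yz , w∈
... | inj₁ refl       | inj₂ (m , refl) =
  b , inj₂ (l , refl) , inj₁ refl , block-step b m z (trans (joined-sym (member b m) z) zw) , inj₂ (m , refl)

-- A windmill of cliques through `hub`. Labels in `Fin 3` limit a block to three members, `mate`
-- gives each member a companion in its block, and `block<n` keeps the number `n` free for the next
-- block.
record Friendship (n : ℕ) : Set where
  field
    code           : Fin n → Code
    code-injective : ∀ {i j} → code i ≡ code j → i ≡ j
    hub            : Fin n
    code-hub       : code hub ≡ centre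
    mate           : ∀ {i b l} → code i ≡ member b l → ∃ λ j → ∃ λ l′ → code j ≡ member b l′ × l ≢ l′
    block<n        : ∀ {i b l} → code i ≡ member b l → b < n

  graph : Graph n
  graph = record
    { adj        = λ i j → joined (code i) (code j)
    ; adj-sym    = λ i j → joined-sym (code i) (code j)
    ; adj-irrefl = λ i → joined-irrefl (code i)
    }

  coloring : Coloring graph
  coloring = record
    { col     = λ i j → colour (code i) (code j)
    ; col-sym = λ i j → colour-sym (code i) (code j)
    }

  private
    A = adj graph
    c = col coloring

  -- A 4-cycle stays within the centre and one block, whose palette has only three colours.
  rainbow-free : ¬ RainbowC4 A c
  rainbow-free (a , b , d , e , ab , ad , ae , bd , be , de , Aab , Abd , Ade , Aea ,
                c₁₂ , c₁₃ , c₁₄ , c₂₃ , c₂₄ , c₃₄)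
    with β , a∈ , b∈ , d∈ , e∈ ← block-of-cycle (code a) (code b) (code d) (code e) Aab Abd Ade Aea
           (λ (p , q) → ad (code-injective (trans p (sym q)))) (λ (p , q) → be (code-injective (trans p (sym q))))
    with l₁ , p₁ ← block-colour a∈ b∈ Aab | l₂ , p₂ ← block-colour b∈ d∈ Abd
       | l₃ , p₃ ← block-colour d∈ e∈ Ade | l₄ , p₄ ← block-colour e∈ a∈ Aea =
    -- Four distinct labels in `Fin 3` would give 4 ≤ 3.
    <⇒≱ ≤-refl (sum-unique-≤ {3} (λ _ → 1) {l₁ ∷ l₂ ∷ l₃ ∷ l₄ ∷ []}
      ((differ p₁ p₂ c₁₂ ∷ differ p₁ p₃ c₁₃ ∷ differ p₁ p₄ c₁₄ ∷ []) ∷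
       (differ p₂ p₃ c₂₃ ∷ differ p₂ p₄ c₂₄ ∷ []) ∷ (differ p₃ p₄ c₃₄ ∷ []) ∷ [] ∷ []))
    where
    differ : ∀ {l l′ p q} → p ≡ paint l β → q ≡ paint l′ β → p ≢ q → l ≢ l′
    differ p≡ q≡ p≢q refl = p≢q (trans p≡ (sym q≡))

  ≢-code : ∀ {i j x y} → code i ≡ x → code j ≡ y → x ≢ y → i ≢ j
  ≢-code p q x≢y refl = x≢y (trans (sym p) q)

  -- The cycle goes from `i` to its mate `i′`, through the hub to `j`, and back along the new edge.
  -- Its first two edges use distinct colours of palette `b` and the third a colour of palette `b′`,
  -- so only three values of `k` spoil it.
  detour-cycle : ∀ {u v k i i′ j b l l′ b′ m} →
    code i ≡ member b l → code i′ ≡ member b l′ → code j ≡ member b′ m → l ≢ l′ → b ≢ b′ →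
    isPair u v j i ≡ true → i′ ≢ u → i′ ≢ v → hub ≢ u → hub ≢ v →
    k ≢ paint (third l l′) b → k ≢ paint l′ b → k ≢ paint m b′ →
    RainbowC4 (addAdj A u v) (addCol c u v k)
  detour-cycle {u} {v} {k} {i} {i′} {j} {b} {l} {l′} {b′} {m} pᵢ pᵢ′ pⱼ
               l≢l′ b≢b′ new i′≢u i′≢v hub≢u hub≢v k≢₁ k≢₂ k≢₃ =
    i , i′ , hub , j ,
    ≢-code pᵢ pᵢ′ (l≢l′ ∘ member-injectiveʳ) , ≢-code pᵢ code-hub (λ ()) , ≢-code pᵢ pⱼ (b≢b′ ∘ member-injectiveˡ) ,
    ≢-code pᵢ′ code-hub (λ ()) , ≢-code pᵢ′ pⱼ (b≢b′ ∘ member-injectiveˡ) , ≢-code code-hub pⱼ (λ ()) ,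
    trans (addAdj-old A i i′ old₁) (trans (cong₂ joined pᵢ pᵢ′) (joined-mates {b} l≢l′)) ,
    trans (addAdj-old A i′ hub old₂) (cong₂ joined pᵢ′ code-hub) ,
    trans (addAdj-old A hub j old₃) (cong₂ joined code-hub pⱼ) ,
    addAdj-new A j i new ,
    differ c₁ c₂ (paint-≢-label b b (third-≢ʳ l≢l′)) , differ c₁ c₃ (paint-≢-block b≢b′) , differ c₁ c₄ (≢-sym k≢₁) ,
    differ c₂ c₃ (paint-≢-block b≢b′) , differ c₂ c₄ (≢-sym k≢₂) , differ c₃ c₄ (≢-sym k≢₃)
    where
    old₁ = isPair-avoidʳ i i′≢u i′≢v
    old₂ = isPair-avoidˡ hub i′≢u i′≢v
    old₃ = isPair-avoidˡ j hub≢u hub≢v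
    c₁ : addCol c u v k i i′ ≡ paint (third l l′) b
    c₁ = trans (addCol-old c i i′ old₁) (trans (cong₂ colour pᵢ pᵢ′) (cong (paint (third l l′)) (⊔-idem b)))
    c₂ : addCol c u v k i′ hub ≡ paint l′ b
    c₂ = trans (addCol-old c i′ hub old₂) (cong₂ colour pᵢ′ code-hub)
    c₃ : addCol c u v k hub j ≡ paint m b′
    c₃ = trans (addCol-old c hub j old₃) (cong₂ colour code-hub pⱼ)
    c₄ : addCol c u v k j i ≡ k
    c₄ = addCol-new c j i new
    differ : ∀ {p q p′ q′ : ℕ} → p ≡ p′ → q ≡ q′ → p′ ≢ q′ → p ≢ q
    differ refl refl ne = ne

  codes-of-non-edge : ∀ {u v} → u ≢ v → A u v ≡ false →
    ∃ λ b → ∃ λ l → ∃ λ b′ → ∃ λ l′ → code u ≡ member b l × code v ≡ member b′ l′ × b ≢ b′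
  codes-of-non-edge {u} {v} u≢v Auv = split (code u) (code v) refl refl
    where
    split : ∀ x y → code u ≡ x → code v ≡ y →
            ∃ λ b → ∃ λ l → ∃ λ b′ → ∃ λ l′ → code u ≡ member b l × code v ≡ member b′ l′ × b ≢ b′
    split centre       centre         p q = contradiction (code-injective (trans p (sym q))) u≢v
    split centre       (member _ _)   p q with () ← trans (sym Auv) (cong₂ joined p q)
    split (member _ _) centre         p q with () ← trans (sym Auv) (cong₂ joined p q)
    split (member b l) (member b′ l′) p q = b , l , b′ , l′ , p , q , b≢b′
      where
      b≢b′ : b ≢ b′
      b≢b′ refl with () ← trans (sym Auv) (trans (cong₂ joined p q)
        (joined-mates {b} {l} {l′} λ { refl → u≢v (code-injective (trans p (sym q))) }))

  isPair-new : ∀ (u v : Fin n) → isPair u v u v ≡ true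
  isPair-new u v rewrite dec-true (u ≟ u) refl | dec-true (v ≟ v) refl = refl

  isPair-new′ : ∀ (u v : Fin n) → isPair u v v u ≡ true
  isPair-new′ u v rewrite dec-true (u ≟ u) refl | dec-true (v ≟ v) refl =
    ∨-zeroʳ (does (v ≟ u) ∧ does (u ≟ v))

  -- There are two routes, through the mate of `u` or through the mate of `v`. Their six edges have
  -- six different colours: the three labels in the palette of `u` and the three in that of `v`.
  -- Hence a colour `k` that spoils one route leaves the other intact.
  saturates : ∀ u v → u ≢ v → A u v ≡ false → ∀ k → RainbowC4 (addAdj A u v) (addCol c u v k)
  saturates u v u≢v Auv k
    with b , l , b′ , m , pᵤ , pᵥ , b≢b′ ← codes-of-non-edge u≢v Auv
    with u′ , l′ , pᵤ′ , l≢l′ ← mate pᵤ | v′ , m′ , pᵥ′ , m≢m′ ← mate pᵥ = choose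
    where
    hub≢u : hub ≢ u
    hub≢u = ≢-code code-hub pᵤ (λ ())
    hub≢v : hub ≢ v
    hub≢v = ≢-code code-hub pᵥ (λ ())
    b′≢b = ≢-sym b≢b′
    short : k ≢ paint (third l l′) b → k ≢ paint l′ b → k ≢ paint m b′ → RainbowC4 (addAdj A u v) (addCol c u v k)
    short = detour-cycle pᵤ pᵤ′ pᵥ l≢l′ b≢b′ (isPair-new′ u v)
      (≢-code pᵤ′ pᵤ (l≢l′ ∘ sym ∘ member-injectiveʳ)) (≢-code pᵤ′ pᵥ (b≢b′ ∘ member-injectiveˡ)) hub≢u hub≢v
    long : k ≢ paint (third m m′) b′ → k ≢ paint m′ b′ → k ≢ paint l b → RainbowC4 (addAdj A u v) (addCol c u v k)
    long = detour-cycle pᵥ pᵥ′ pᵤ m≢m′ b′≢b (isPair-new u v)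
      (≢-code pᵥ′ pᵤ (b′≢b ∘ member-injectiveˡ)) (≢-code pᵥ′ pᵥ (m≢m′ ∘ sym ∘ member-injectiveʳ)) hub≢u hub≢v
    choose : RainbowC4 (addAdj A u v) (addCol c u v k)
    choose with k ℕ.≟ paint (third l l′) b | k ℕ.≟ paint l′ b | k ℕ.≟ paint m b′
    ... | no p     | no q     | no r     = short p q r
    ... | yes refl | _        | _        =
      long (paint-≢-block b≢b′) (paint-≢-block b≢b′) (paint-≢-label b b (third-≢ˡ l≢l′))
    ... | no _     | yes refl | _        =
      long (paint-≢-block b≢b′) (paint-≢-block b≢b′) (paint-≢-label b b (≢-sym l≢l′))
    ... | no _     | no _     | yes refl =
      long (paint-≢-label b′ b′ (≢-sym (third-≢ˡ m≢m′))) (paint-≢-label b′ b′ m≢m′) (paint-≢-block b′≢b)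

  saturated : RainbowSaturatedC4 graph coloring
  saturated = rainbow-free , saturates

  -- No vertex lies in block `n` yet, so a new member of this block is joined to the hub alone.
  hub-row : ∀ l → sum (λ j → if joined (member n l) (code j) then 1 else 0) ≡ 1
  hub-row l = trans (sum-cong-≗ row) (sum-indicator hub 1)
    where
    row : ∀ j → (if joined (member n l) (code j) then 1 else 0) ≡ indicator hub 1 j
    row j with j ≟ hub
    ... | yes refl rewrite code-hub = refl
    ... | no j≢hub with code j in eq
    ...   | centre = contradiction (code-injective (trans eq (sym code-hub))) j≢hub
    ...   | member b _ rewrite ≡ᵇ-≢ (>⇒≢ (block<n eq)) = refl

open Friendship

-- Building a graph of every order

add-triangle : Friendship n → Friendship (2 + n)
add-triangle {n} F = record
  { code           = code⁺
  ; code-injective = λ {i} {j} → injective i j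
  ; hub            = suc (suc (hub F))
  ; code-hub       = code-hub F
  ; mate           = λ {i} → mate⁺ i
  ; block<n        = λ {i} → block⁺ i
  }
  where
  code⁺ : Fin (2 + n) → Code
  code⁺ zero          = member n 0F
  code⁺ (suc zero)    = member n 1F
  code⁺ (suc (suc i)) = code F i
  old : ∀ {l} j → member n l ≢ code F j
  old j eq = <-irrefl refl (block<n F (sym eq))
  injective : ∀ i j → code⁺ i ≡ code⁺ j → i ≡ j
  injective zero          zero          _  = refl
  injective (suc zero)    (suc zero)    _  = refl
  injective zero          (suc (suc j)) eq = contradiction eq (old j)
  injective (suc zero)    (suc (suc j)) eq = contradiction eq (old j)
  injective (suc (suc i)) zero          eq = contradiction (sym eq) (old i)
  injective (suc (suc i)) (suc zero)    eq = contradiction (sym eq) (old i)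
  injective (suc (suc i)) (suc (suc j)) eq = cong (λ i → suc (suc i)) (code-injective F eq)
  mate⁺ : ∀ i {b l} → code⁺ i ≡ member b l → ∃ λ j → ∃ λ l′ → code⁺ j ≡ member b l′ × l ≢ l′
  mate⁺ zero          refl = suc zero , 1F , refl , λ ()
  mate⁺ (suc zero)    refl = zero , 0F , refl , λ ()
  mate⁺ (suc (suc i)) eq with j , l′ , p , ne ← mate F eq = suc (suc j) , l′ , p , ne
  block⁺ : ∀ i {b l} → code⁺ i ≡ member b l → b < 2 + n
  block⁺ zero          refl = s≤s (n≤1+n n)
  block⁺ (suc zero)    refl = s≤s (n≤1+n n)
  block⁺ (suc (suc i)) eq   = ≤-trans (block<n F eq) (m≤n+m n 2)

edgeCount-add-triangle : (F : Friendship n) → edgeCount (graph (add-triangle F)) ≡ 3 + edgeCount (graph F)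
edgeCount-add-triangle {n} F = begin
  edgeCount (graph (add-triangle F))
    ≡⟨ edgeCount-pairCount (graph (add-triangle F)) ⟩
  -- The rows of the two new vertices unfold to the edge between them and, in each `row`, the single
  -- edge to the hub.
  (if (n ≡ᵇ n) ∧ true then 1 else 0) + row 0F + (row 1F + pairCount (adj (graph F)))
    ≡⟨ cong₂ (λ b s → (if b ∧ true then 1 else 0) + s + (row 1F + pairCount (adj (graph F))))
          (≡ᵇ-refl n) (hub-row F 0F) ⟩
  2 + (row 1F + pairCount (adj (graph F)))
    ≡⟨ cong₂ (λ s t → 2 + (s + t)) (hub-row F 1F) (sym (edgeCount-pairCount (graph F))) ⟩
  3 + edgeCount (graph F) ∎
  where
  open ≡-Reasoning
  row : Fin 3 → ℕ
  row l = sum (λ j → if joined (member n l) (code F j) then 1 else 0)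

single : Friendship 1
single = record
  { code           = λ _ → centre
  ; code-injective = λ { {zero} {zero} _ → refl }
  ; hub            = zero
  ; code-hub       = refl
  ; mate           = λ ()
  ; block<n        = λ ()
  }

K₄ : Friendship 4
K₄ = record
  { code           = code₄
  ; code-injective = λ { {zero} {zero} _ → refl ; {suc i} {suc j} eq → cong suc (member-injectiveʳ eq) }
  ; hub            = zero
  ; code-hub       = refl
  ; mate           = λ { {suc i} refl → mate₄ i }
  ; block<n        = λ { {suc i} refl → s≤s z≤n }
  }
  where
  code₄ : Fin 4 → Code
  code₄ zero    = centre
  code₄ (suc i) = member 0 i
  mate₄ : ∀ i → ∃ λ j → ∃ λ l′ → code₄ j ≡ member 0 l′ × i ≢ l′
  mate₄ 0F = 2F , 1F , refl , λ ()
  mate₄ 1F = 1F , 0F , refl , λ ()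
  mate₄ 2F = 1F , 0F , refl , λ ()

-- Odd orders grow from a triangle and even orders from `K₄`; each step adds two vertices and three
-- edges.
friendship : ∀ k → Friendship (3 + k)
friendship 0             = add-triangle single
friendship 1             = K₄
friendship (suc (suc k)) = add-triangle (friendship k)

edgeCount-friendship : ∀ k → edgeCount (graph (friendship k)) ≡ 3 * ⌈ 2 + k /2⌉
edgeCount-friendship 0             = refl
edgeCount-friendship 1             = refl
edgeCount-friendship (suc (suc k)) = begin
  edgeCount (graph (add-triangle (friendship k)))    ≡⟨ edgeCount-add-triangle (friendship k) ⟩
  3 + edgeCount (graph (friendship k))               ≡⟨ cong (3 +_) (edgeCount-friendship k) ⟩
  3 + 3 * ⌈ 2 + k /2⌉                                ≡⟨ *-suc 3 ⌈ 2 + k /2⌉ ⟨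
  3 * ⌈ 4 + k /2⌉                                    ∎
  where open ≡-Reasoning

upper-bound : ∀ {n} → 5 ≤ n → Σ (Graph n) λ G → Σ (Coloring G) λ C →
              RainbowSaturatedC4 G C × edgeCount G ≡ 3 * ⌈ n ∸ 1 /2⌉
upper-bound {suc (suc (suc k))} (s≤s (s≤s (s≤s _))) = graph F , coloring F , saturated F , edgeCount-friendship k
  where F = friendship k

theorem1p1 : ∀ (n : ℕ) → 5 ≤ n → RsatC4 n (3 * ⌈ n ∸ 1 /2⌉)
theorem1p1 n 5≤n = upper-bound 5≤n , lower-bound 5≤n
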